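{- Let $p,q\ge 2$ be integers. There is a tight chiral polyhedron of type $\{p, q\}$ and one of type $\{q, p\}$ under any of the following conditions: (a) $q$ is odd, $p$ is an even divisor of $2q$, and there is an odd prime $m$ such that $m$ divides $p$ and $m^2$ divides $q$; (b) $p$ and $q$ are both even, and there is an odd prime $m$ such that $m$ divides $p$ and $m^2$ divides $q$; (c) $p$ is divisible by $8$ and $q$ is divisible by $32$.
   Context: An (abstract) polyhedron is a partially ordered set whose elements have rank $0$ (vertices), $1$ (edges) or $2$ (faces), where two elements are incident if they are comparable, such that: every edge is incident to exactly two vertices and two faces; whenever a vertex is incident to a face there are exactly two edges incident to both; the graph of the incidence relation is connected; and for every vertex or face $F$, the subgraph of the incidence graph induced on the neighbours of $F$ is connected. A flag is a mutually incident triple (vertex, edge, face); for a flag $\Phi$ and $i\in\{0,1,2\}$, $\Phi^i$ denotes the unique flag differing from $\Phi$ exactly in its rank-$i$ element. The polyhedron has type (Schläfli symbol) $\{p,q\}$ if every face is incident to exactly $p$ edges and every vertex to exactly $q$ edges. An automorphism is an incidence-preserving bijection. The polyhedron is chiral if its flags can be split into two classes such that flags $\Phi$ and $\Phi^i$ always lie in different classes and the automorphism group acts transitively on each class but not on all flags. A polyhedron of type $\{p,q\}$ has at least $2pq$ flags; it is called tight if it has exactly $2pq$ flags. -}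

module Defs where

open import Data.Nat using (ℕ; zero; suc; _+_; _*_; _≤_)
open import Data.Nat.Divisibility using (_∣_)
open import Data.Nat.Primality using (Prime)
open import Data.Fin using (Fin; zero; suc)
open import Data.Fin.Permutation using (Permutation′; _⟨$⟩ʳ_)
open import Data.Bool using (Bool; true; false; _∧_)
open import Data.Sum using (_⊎_; inj₁; inj₂)
open import Data.Product using (Σ; _×_; _,_; ∃)
open import Relation.Nullary using (¬_)
open import Relation.Binary.PropositionalEquality using (_≡_)

countF : (n : ℕ) → (Fin n → Bool) → ℕ
countF zero    P = 0
countF (suc n) P with P zero
... | true  = suc (countF n (λ i → P (suc i)))
... | false = countF n (λ i → P (suc i))

sumF : (n : ℕ) → (Fin n → ℕ) → ℕ
sumF zero    g = 0
sumF (suc n) g = g zero + sumF n (λ i → g (suc i))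

data PathIn {A : Set} (P : A → Bool) (R : A → A → Bool) : A → A → Set where
  here : ∀ {x} → PathIn P R x x
  step : ∀ {x y z} → R x y ≡ true → P y ≡ true → PathIn P R y z → PathIn P R x z

ConnectedOn : {A : Set} → (A → Bool) → (A → A → Bool) → Set
ConnectedOn {A} P R = (x y : A) → P x ≡ true → P y ≡ true → PathIn P R x y

-- A ranked poset with ranks 0,1,2: elements of rank 0 (vertices, Fin nV),
-- rank 1 (edges, Fin nE) and rank 2 (faces, Fin nF); the order relation
-- between elements of different ranks is given by Boolean relations.
record RankedPoset : Set where
  field
    nV nE nF : ℕ
    VE : Fin nV → Fin nE → Bool
    EF : Fin nE → Fin nF → Bool
    VF : Fin nV → Fin nF → Bool

  Elem : Set
  Elem = Fin nV ⊎ (Fin nE ⊎ Fin nF)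

  inc : Elem → Elem → Bool
  inc (inj₁ v)        (inj₂ (inj₁ e)) = VE v e
  inc (inj₁ v)        (inj₂ (inj₂ f)) = VF v f
  inc (inj₂ (inj₁ e)) (inj₁ v)        = VE v e
  inc (inj₂ (inj₁ e)) (inj₂ (inj₂ f)) = EF e f
  inc (inj₂ (inj₂ f)) (inj₁ v)        = VF v f
  inc (inj₂ (inj₂ f)) (inj₂ (inj₁ e)) = EF e f
  inc _ _ = false

  record Flag : Set where
    constructor flag
    field
      fv : Fin nV
      fe : Fin nE
      ff : Fin nF
      isFlag : (VE fv fe ∧ (EF fe ff ∧ VF fv ff)) ≡ true

  numFlags : ℕ
  numFlags = sumF nV (λ v → sumF nE (λ e → countF nF (λ f → VE v e ∧ (EF e f ∧ VF v f))))

  open Flag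

  Adj : Fin 3 → Flag → Flag → Set
  Adj zero          Φ Ψ = ¬ (fv Φ ≡ fv Ψ) × (fe Φ ≡ fe Ψ) × (ff Φ ≡ ff Ψ)
  Adj (suc zero)    Φ Ψ = (fv Φ ≡ fv Ψ) × ¬ (fe Φ ≡ fe Ψ) × (ff Φ ≡ ff Ψ)
  Adj (suc (suc _)) Φ Ψ = (fv Φ ≡ fv Ψ) × (fe Φ ≡ fe Ψ) × ¬ (ff Φ ≡ ff Ψ)

  record IsPolyhedron : Set where
    field
      trans-VEF : ∀ v e f → VE v e ≡ true → EF e f ≡ true → VF v f ≡ true
      edge-2V : ∀ e → countF nV (λ v → VE v e) ≡ 2
      edge-2F : ∀ e → countF nF (λ f → EF e f) ≡ 2
      diamond : ∀ v f → VF v f ≡ true → countF nE (λ e → VE v e ∧ EF e f) ≡ 2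
      connected : ConnectedOn (λ _ → true) inc
      vertex-link : ∀ v → ConnectedOn (inc (inj₁ v)) inc
      face-link   : ∀ f → ConnectedOn (inc (inj₂ (inj₂ f))) inc

  HasType : ℕ → ℕ → Set
  HasType p q = (∀ f → countF nE (λ e → EF e f) ≡ p) × (∀ v → countF nE (λ e → VE v e) ≡ q)

  record Automorphism : Set where
    field
      σV : Permutation′ nV
      σE : Permutation′ nE
      σF : Permutation′ nF
      pres-VE : ∀ v e → VE (σV ⟨$⟩ʳ v) (σE ⟨$⟩ʳ e) ≡ VE v e
      pres-EF : ∀ e f → EF (σE ⟨$⟩ʳ e) (σF ⟨$⟩ʳ f) ≡ EF e f
      pres-VF : ∀ v f → VF (σV ⟨$⟩ʳ v) (σF ⟨$⟩ʳ f) ≡ VF v f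

    Maps : Flag → Flag → Set
    Maps Φ Ψ = (σV ⟨$⟩ʳ fv Φ ≡ fv Ψ) × (σE ⟨$⟩ʳ fe Φ ≡ fe Ψ) × (σF ⟨$⟩ʳ ff Φ ≡ ff Ψ)

  open Automorphism

  IsChiral : Set
  IsChiral = Σ (Flag → Bool) λ c →
      (∀ i Φ Ψ → Adj i Φ Ψ → ¬ (c Φ ≡ c Ψ))
    × (∀ Φ Ψ → c Φ ≡ c Ψ → Σ Automorphism λ α → Maps α Φ Ψ)
    × ¬ (∀ Φ Ψ → Σ Automorphism λ α → Maps α Φ Ψ)

TightChiralPolyhedron : ℕ → ℕ → Set
TightChiralPolyhedron p q = Σ RankedPoset λ P →
  let open RankedPoset P in
  IsPolyhedron × HasType p q × IsChiral × (numFlags ≡ 2 * p * q)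

OddPrimeCond : ℕ → ℕ → Set
OddPrimeCond p q = ∃ λ m → Prime m × ¬ (2 ∣ m) × (m ∣ p) × (m * m ∣ q)

CondA CondB CondC : ℕ → ℕ → Set
CondA p q = ¬ (2 ∣ q) × (2 ∣ p) × (p ∣ 2 * q) × OddPrimeCond p q
CondB p q = (2 ∣ p) × (2 ∣ q) × OddPrimeCond p q
CondC p q = (8 ∣ p) × (32 ∣ q)

{-# OPTIONS --safe #-}

-- A tight polyhedron of type {p,q} has a rotation group G = ⟨σ₁⟩⟨σ₂⟩ of order pq.  Here p is even and
-- G = N ⋊ ⟨σ₁σ₂⟩, where N is generated by x = σ₂, of order q, and its conjugate y by σ₁σ₂; u = xy has
-- order p/2.  Edges are the elements of N, vertices the cosets of ⟨x⟩ and of ⟨y⟩, and faces the cosets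
-- of ⟨u⟩.  Write p/2 = Pw with P and w coprime.  The Hall subgroup of order w of ⟨u⟩ is inverted by x,
-- while x and the generator u₁ of the one of order P have a central commutator z, and we impose the
-- relation z = u₁²ˢ x⁻⁴ˢ for a suitable s.  A reflection would invert x and y, hence fix [x,u₁] = z but
-- invert its expression u₁²ˢ x⁻⁴ˢ, so the polyhedron is chiral as soon as z² is nontrivial.
-- Duality allows us to assume that the relevant prime divides p/2 at most as often as q.
module Submission where

open import Defs
open import Data.Bool using (Bool; true; false; _∧_; _∨_)
open import Data.Bool.Properties using (∧-comm; ∧-zeroʳ)
open import Data.Fin using (Fin; zero; suc; toℕ; fromℕ<; combine; remQuot; _≟_)
open import Data.Fin.Permutation using (Permutation′; _⟨$⟩ʳ_; _⟨$⟩ˡ_; permutation; inverseˡ)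
open import Data.Fin.Properties using (injective⇒≤; suc-injective; toℕ<n; toℕ-injective; toℕ-fromℕ<; remQuot-combine; combine-remQuot; combine-injectiveˡ; combine-injectiveʳ)
open import Data.Integer using (ℤ; +_; -_; _+_; _*_; _-_) renaming (∣_∣ to abs)
open import Data.Integer.DivMod using (_%ℕ_; _/ℕ_; n%ℕd<d; a≡a%ℕn+[a/ℕn]*n)
open import Data.Integer.Divisibility.Signed using (_∣_; divides; ∣-trans; ∣-refl; ∣⇒∣ᵤ; ∣ᵤ⇒∣; ∣m∣n⇒∣m+n; ∣m⇒∣-m; ∣n⇒∣m*n)
import Data.Integer.Properties as ℤ
open import Data.Integer.Tactic.RingSolver using (solve-∀)
open import Data.Nat using (ℕ; zero; suc; NonZero; _≤_; _<_; z≤n; s≤s)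
import Data.Nat as ℕ
open import Data.Nat.Coprimality using (Coprime; coprime-Bézout; coprime-divisor)
open import Data.Nat.Divisibility using (divides)
import Data.Nat.Divisibility as ℕ
open import Data.Nat.GCD using (module Bézout)
open import Data.Nat.Induction using (<-wellFounded)
open import Data.Nat.Primality using (Prime; prime⇒irreducible; prime⇒nonZero; prime⇒nonTrivial; euclidsLemma; prime[2]; ¬prime[1]; irreducible[2])
import Data.Nat.Properties as ℕ
import Data.Nat.Tactic.RingSolver as ℕSolver
open import Data.Product using (Σ; _×_; _,_; ∃; proj₁; proj₂)
open import Data.Sum using (_⊎_; inj₁; inj₂; [_,_]′)
open import Function using (id; _∘_)
open import Induction.WellFounded using (Acc; acc)
open import Relation.Binary.PropositionalEquality using (_≡_; _≢_; refl; sym; trans; cong; cong₂; subst; subst₂; module ≡-Reasoning)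
open import Relation.Nullary using (¬_; contradiction; yes; no; does)
open import Relation.Nullary.Decidable using (dec-true)

-- The exponents 2s and -4s come from the automorphism exchanging x and y. It sends z to z⁻¹ and u₁
-- to u₁z⁻¹, hence u₁ⁱxʲ to u₁ⁱ⁺ʲx⁻ʲ up to a power of z. So a relation z = u₁ⁱxʲ is respected if j =
-- -2i and that power of z dies; an even i removes the halves from the triangular numbers that occur
-- in powers of y. The splitting of p/2 comes from y having order q too. Up to powers of z, the
-- power of y with exponent q contains that power of u₁, so the order of u₁ must divide q. In
-- contrast y² contains no u₂, so for even q the order of u₂ is free. All computations take place in
-- an infinite cover of N in which z is an independent central element. There the group laws, the
-- exchange of x and y and even the reflection are identities between integers; the finite group is
-- seen only through labels modulo P, w and q. Chirality means that the reflection of the cover does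
-- not descend.

-- Counting by bijections

nth : ∀ {n} → (P : Fin n → Bool) → Fin (countF n P) → Fin n
nth {suc n} P i with P zero
nth {suc n} P zero    | true = zero
nth {suc n} P (suc i) | true = suc (nth (λ j → P (suc j)) i)
nth {suc n} P i       | false = suc (nth (λ j → P (suc j)) i)

nth-holds : ∀ {n} → (P : Fin n → Bool) (i : Fin (countF n P)) → P (nth P i) ≡ true
nth-holds {suc n} P i with P zero in eq
nth-holds {suc n} P zero    | true = eq
nth-holds {suc n} P (suc i) | true = nth-holds (λ j → P (suc j)) i
nth-holds {suc n} P i       | false = nth-holds (λ j → P (suc j)) i

nth-injective : ∀ {n} → (P : Fin n → Bool) {i j : Fin (countF n P)} → nth P i ≡ nth P j → i ≡ j
nth-injective {suc n} P {i} {j} e with P zero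
nth-injective {suc n} P {zero}  {zero}  e | true = refl
nth-injective {suc n} P {suc i} {suc j} e | true =
  cong suc (nth-injective (λ j → P (suc j)) (suc-injective e))
nth-injective {suc n} P {i} {j} e | false = nth-injective (λ j → P (suc j)) (suc-injective e)

rank : ∀ {n} → (P : Fin n → Bool) (j : Fin n) → P j ≡ true → ∃ λ i → nth P i ≡ j
rank {suc n} P zero h with P zero
rank {suc n} P zero h  | true = zero , refl
rank {suc n} P zero () | false
rank {suc n} P (suc j) h with P zero
... | true  = let i , e = rank (λ j → P (suc j)) j h in suc i , cong suc e
... | false = let i , e = rank (λ j → P (suc j)) j h in i , cong suc e

-- An injection in each direction gives the two inequalities. All incidence numbers of the
-- polyhedron are obtained by feeding an explicit parametrisation to this lemma.
countF-bijection : ∀ {n k} → (P : Fin n → Bool) (f : Fin k → Fin n) →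
  (∀ {i j} → f i ≡ f j → i ≡ j) → (∀ i → P (f i) ≡ true) →
  (∀ j → P j ≡ true → ∃ λ i → f i ≡ j) → countF n P ≡ k
countF-bijection {n} {k} P f f-inj f-holds f-onto =
  ℕ.≤-antisym (injective⇒≤ {f = to} to-inj) (injective⇒≤ {f = from} from-inj)
  where
  to : Fin (countF n P) → Fin k
  to i = proj₁ (f-onto (nth P i) (nth-holds P i))
  to-inj : ∀ {i j} → to i ≡ to j → i ≡ j
  to-inj {i} {j} e = nth-injective P
    (trans (sym (proj₂ (f-onto (nth P i) (nth-holds P i))))
      (trans (cong f e) (proj₂ (f-onto (nth P j) (nth-holds P j)))))
  from : Fin k → Fin (countF n P)
  from i = proj₁ (rank P (f i) (f-holds i))
  from-inj : ∀ {i j} → from i ≡ from j → i ≡ j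
  from-inj {i} {j} e = f-inj
    (trans (sym (proj₂ (rank P (f i) (f-holds i))))
      (trans (cong (nth P) e) (proj₂ (rank P (f j) (f-holds j)))))

countF-cong : ∀ {n} → (P Q : Fin n → Bool) → (∀ i → P i ≡ Q i) → countF n P ≡ countF n Q
countF-cong {zero}  P Q e = refl
countF-cong {suc n} P Q e rewrite e zero with Q zero
... | true  = cong suc (countF-cong _ _ (λ i → e (suc i)))
... | false = countF-cong _ _ (λ i → e (suc i))

countF-false : ∀ n → countF n (λ _ → false) ≡ 0
countF-false zero    = refl
countF-false (suc n) = countF-false n

sumF-cong : ∀ {n} → (g h : Fin n → ℕ) → (∀ i → g i ≡ h i) → sumF n g ≡ sumF n h
sumF-cong {zero}  g h e = refl
sumF-cong {suc n} g h e = cong₂ ℕ._+_ (e zero) (sumF-cong _ _ (λ i → e (suc i)))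

sumF-const : ∀ n c → sumF n (λ _ → c) ≡ n ℕ.* c
sumF-const zero    c = refl
sumF-const (suc n) c = cong (c ℕ.+_) (sumF-const n c)

sumF-on : ∀ {n} → (P : Fin n → Bool) (g : Fin n → ℕ) (c : ℕ) →
  (∀ i → P i ≡ true → g i ≡ c) → (∀ i → P i ≡ false → g i ≡ 0) →
  sumF n g ≡ countF n P ℕ.* c
sumF-on {zero}  P g c on off = refl
sumF-on {suc n} P g c on off with P zero in eq
... | true  = cong₂ ℕ._+_ (on zero eq) (sumF-on (λ i → P (suc i)) _ c (λ i → on (suc i)) (λ i → off (suc i)))
... | false = cong₂ ℕ._+_ (off zero eq) (sumF-on (λ i → P (suc i)) _ c (λ i → on (suc i)) (λ i → off (suc i)))

-- Tightness and duality

-- Tightness is recorded by the numbers of vertices and faces, which duality just exchanges. The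
-- flag count follows: p vertices, q edges at each, two faces at each edge.
record ChiralPolyhedron (p q : ℕ) : Set where
  field
    poset : RankedPoset
  open RankedPoset poset public
  field
    isPolyhedron : IsPolyhedron
    hasType      : HasType p q
    isChiral     : IsChiral
    vertices     : nV ≡ p
    faces        : nF ≡ q

PathIn-map : {A B : Set} {P : A → Bool} {Q : B → Bool} {R : A → A → Bool} {S : B → B → Bool}
  (f : A → B) → (∀ x → P x ≡ true → Q (f x) ≡ true) → (∀ x y → R x y ≡ true → S (f x) (f y) ≡ true) →
  ∀ {x y} → PathIn P R x y → PathIn Q S (f x) (f y)
PathIn-map f hP hR here = here
PathIn-map f hP hR (step r p π) = step (hR _ _ r) (hP _ p) (PathIn-map f hP hR π)

∧-trueˡ : ∀ {a b} → a ∧ b ≡ true → a ≡ true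
∧-trueˡ {true} h = refl

∧-trueʳ : ∀ {a b} → a ∧ b ≡ true → b ≡ true
∧-trueʳ {true} h = h

∧-true : ∀ {a b} → a ≡ true → b ≡ true → a ∧ b ≡ true
∧-true refl refl = refl

∧-swap : ∀ a b c → a ∧ (b ∧ c) ≡ b ∧ (a ∧ c)
∧-swap true  b c = refl
∧-swap false b c = sym (∧-zeroʳ b)

tight : ∀ {p q} → ChiralPolyhedron p q → TightChiralPolyhedron p q
tight {p} {q} C = poset , isPolyhedron , hasType , isChiral , flags
  where
  open ChiralPolyhedron C
  open IsPolyhedron isPolyhedron
  onEdge : ∀ v e → VE v e ≡ true → countF nF (λ f → VE v e ∧ (EF e f ∧ VF v f)) ≡ 2
  onEdge v e h = trans (countF-cong _ _ same) (edge-2F e)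
    where
    same : ∀ f → VE v e ∧ (EF e f ∧ VF v f) ≡ EF e f
    same f rewrite h with EF e f in eq
    ... | true  = trans-VEF v e f h eq
    ... | false = refl
  offEdge : ∀ v e → VE v e ≡ false → countF nF (λ f → VE v e ∧ (EF e f ∧ VF v f)) ≡ 0
  offEdge v e h = trans (countF-cong {nF} _ _ (λ f → cong (_∧ (EF e f ∧ VF v f)) h)) (countF-false nF)
  flags : numFlags ≡ 2 ℕ.* p ℕ.* q
  flags = begin
    numFlags                  ≡⟨ sumF-cong _ _ (λ v → trans
                                   (sumF-on (VE v) _ 2 (onEdge v) (offEdge v))
                                   (cong (ℕ._* 2) (proj₂ hasType v))) ⟩
    sumF nV (λ _ → q ℕ.* 2)     ≡⟨ sumF-const nV (q ℕ.* 2) ⟩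
    nV ℕ.* (q ℕ.* 2)              ≡⟨ cong (ℕ._* (q ℕ.* 2)) vertices ⟩
    p ℕ.* (q ℕ.* 2)               ≡⟨ sym (ℕ.*-assoc p q 2) ⟩
    p ℕ.* q ℕ.* 2                 ≡⟨ ℕ.*-comm (p ℕ.* q) 2 ⟩
    2 ℕ.* (p ℕ.* q)               ≡⟨ sym (ℕ.*-assoc 2 p q) ⟩
    2 ℕ.* p ℕ.* q                 ∎
    where open ≡-Reasoning

dual : RankedPoset → RankedPoset
dual P = record { nV = nF ; nE = nE ; nF = nV
                ; VE = λ f e → EF e f ; EF = λ e v → VE v e ; VF = λ f v → VF v f }
  where open RankedPoset P

module Dual (P : RankedPoset) where
  open RankedPoset P
  module P* = RankedPoset (dual P)

  elem* : Elem → P*.Elem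
  elem* (inj₁ v)        = inj₂ (inj₂ v)
  elem* (inj₂ (inj₁ e)) = inj₂ (inj₁ e)
  elem* (inj₂ (inj₂ f)) = inj₁ f

  inc* : ∀ x y → inc x y ≡ true → P*.inc (elem* x) (elem* y) ≡ true
  inc* (inj₁ v)        (inj₂ (inj₁ e)) h = h
  inc* (inj₁ v)        (inj₂ (inj₂ f)) h = h
  inc* (inj₂ (inj₁ e)) (inj₁ v)        h = h
  inc* (inj₂ (inj₁ e)) (inj₂ (inj₂ f)) h = h
  inc* (inj₂ (inj₂ f)) (inj₁ v)        h = h
  inc* (inj₂ (inj₂ f)) (inj₂ (inj₁ e)) h = h

  flag* : Flag → P*.Flag
  flag* (flag v e f h) = P*.flag f e v
    (trans (∧-swap (EF e f) (VE v e) (VF v f)) h)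

  automorphism* : Automorphism → P*.Automorphism
  automorphism* α = record { σV = σF ; σE = σE ; σF = σV
    ; pres-VE = λ f e → pres-EF e f ; pres-EF = λ e v → pres-VE v e ; pres-VF = λ f v → pres-VF v f }
    where open Automorphism α

ChiralPolyhedron-dual : ∀ {p q} → ChiralPolyhedron p q → ChiralPolyhedron q p
ChiralPolyhedron-dual {p} {q} C = record
  { poset = dual poset
  ; isPolyhedron = record
    { trans-VEF = λ f e v hf hv → trans-VEF v e f hv hf
    ; edge-2V = edge-2F
    ; edge-2F = edge-2V
    ; diamond = λ f v h → trans (countF-cong _ _ (λ e → ∧-comm (EF e f) (VE v e))) (diamond v f h)
    ; connected = λ x y hx hy → transport (λ _ → true) (λ _ → true) (λ _ _ → refl) x y
        (connected (D*.elem* x) (D*.elem* y) refl refl)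
    ; vertex-link = λ f x y hx hy → transport (inc (inj₂ (inj₂ f))) (D.P*.inc (inj₁ f))
        (λ z → D.inc* (inj₂ (inj₂ f)) z) x y
        (face-link f (D*.elem* x) (D*.elem* y)
          (D*.inc* (inj₁ f) x hx) (D*.inc* (inj₁ f) y hy))
    ; face-link = λ v x y hx hy → transport (inc (inj₁ v)) (D.P*.inc (inj₂ (inj₂ v)))
        (λ z → D.inc* (inj₁ v) z) x y
        (vertex-link v (D*.elem* x) (D*.elem* y)
          (D*.inc* (inj₂ (inj₂ v)) x hx) (D*.inc* (inj₂ (inj₂ v)) y hy)) }
  ; hasType = proj₂ hasType , proj₁ hasType
  ; isChiral = let c , adj , transitive , intransitive = isChiral in
      (λ Φ → c (D*.flag* Φ))
    , (λ { zero Φ Ψ (a , b , d) → adj (suc (suc zero)) (D*.flag* Φ) (D*.flag* Ψ) (d , b , a)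
         ; (suc zero) Φ Ψ (a , b , d) → adj (suc zero) (D*.flag* Φ) (D*.flag* Ψ) (d , b , a)
         ; (suc (suc _)) Φ Ψ (a , b , d) → adj zero (D*.flag* Φ) (D*.flag* Ψ) (d , b , a) })
    , (λ Φ Ψ e → let α , mV , mE , mF = transitive (D*.flag* Φ) (D*.flag* Ψ) e in
         D.automorphism* α , mF , mE , mV)
    , (λ all → intransitive λ Φ Ψ → let α , mV , mE , mF = all (D.flag* Φ) (D.flag* Ψ) in
         D*.automorphism* α , mF , mE , mV)
  ; vertices = faces
  ; faces = vertices }
  where
  open ChiralPolyhedron C
  open IsPolyhedron isPolyhedron
  module D = Dual poset
  module D* = Dual (dual poset)
  elem** : ∀ x → D.elem* (D*.elem* x) ≡ x
  elem** (inj₁ _)        = refl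
  elem** (inj₂ (inj₁ _)) = refl
  elem** (inj₂ (inj₂ _)) = refl
  transport : (P : Elem → Bool) (Q : D.P*.Elem → Bool) →
    (∀ z → P z ≡ true → Q (D.elem* z) ≡ true) → ∀ x y →
    PathIn P inc (D*.elem* x) (D*.elem* y) → PathIn Q D.P*.inc x y
  transport P Q h x y π = subst₂ (PathIn Q D.P*.inc) (elem** x) (elem** y)
    (PathIn-map D.elem* h D.inc* π)

-- The two sides of an edge, and the group data needed for a polyhedron

iterate : {A : Set} → (A → A) → ℕ → A → A
iterate f zero    x = x
iterate f (suc k) x = iterate f k (f x)

flip : Fin 2 → Fin 2
flip zero       = suc zero
flip (suc zero) = zero

flip-involutive : ∀ s → flip (flip s) ≡ s
flip-involutive zero       = refl
flip-involutive (suc zero) = refl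

flip-≢ : ∀ s → flip s ≢ s
flip-≢ zero       ()
flip-≢ (suc zero) ()

≢⇒flip : ∀ {s t : Fin 2} → s ≢ t → s ≡ flip t
≢⇒flip {zero}     {zero}     h = contradiction refl h
≢⇒flip {zero}     {suc zero} h = refl
≢⇒flip {suc zero} {zero}     h = refl
≢⇒flip {suc zero} {suc zero} h = contradiction refl h

-- Flags will be coloured by whether the side of their vertex equals the side of their face. Passing
-- to an adjacent flag has to change the colour.
≟-changesʳ : ∀ (a b c d : Fin 2) → a ≡ c → b ≢ d → does (a ≟ b) ≢ does (c ≟ d)
≟-changesʳ a b .a d refl b≢d rewrite ≢⇒flip b≢d = lem a d
  where
  lem : ∀ (a d : Fin 2) → does (a ≟ flip d) ≢ does (a ≟ d)
  lem zero       zero       ()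
  lem zero       (suc zero) ()
  lem (suc zero) zero       ()
  lem (suc zero) (suc zero) ()

≟-changesˡ : ∀ (a b c d : Fin 2) → a ≢ c → b ≡ d → does (a ≟ b) ≢ does (c ≟ d)
≟-changesˡ a b c .b a≢c refl rewrite ≢⇒flip a≢c = lem b c
  where
  lem : ∀ (b c : Fin 2) → does (flip c ≟ b) ≢ does (c ≟ b)
  lem zero       zero       ()
  lem zero       (suc zero) ()
  lem (suc zero) zero       ()
  lem (suc zero) (suc zero) ()

-- Pairs of words in the generators x and y, the second with x and y replaced by their inverses.
data Mirror {A : Set} (X X⁻ Y Y⁻ : A → A) (o : A) : A → A → Set where
  base : Mirror X X⁻ Y Y⁻ o o o
  mirX : ∀ {h m} → Mirror X X⁻ Y Y⁻ o h m → Mirror X X⁻ Y Y⁻ o (X h) (X⁻ m)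
  mirY : ∀ {h m} → Mirror X X⁻ Y Y⁻ o h m → Mirror X X⁻ Y Y⁻ o (Y h) (Y⁻ m)

-- E is (a cover of) the index-2 subgroup N of the rotation group G = N ⋊ ⟨T⟩, with T = σ₁σ₂;
-- X is right multiplication by x = σ₂, and Y right multiplication by y = T x T.
-- The label α names the coset e⟨x⟩ and γ the coset e⟨xy⟩ (note xy = σ₁⁻²), so that two
-- elements of E stand for the same element of N when both labels agree.
record Rotary (n q : ℕ) : Set₁ where
  field
    E      : Set
    α      : E → Fin n
    γ      : E → Fin q
    X X⁻ T : E → E

  infix 4 _≈_

  _≈_ : E → E → Set
  _≈_ e e′ = α e ≡ α e′ × γ e ≡ γ e′

  Y : E → E
  Y e = T (X (T e))

  Y⁻ : E → E
  Y⁻ e = T (X⁻ (T e))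

  field
    X-X⁻    : ∀ e → X (X⁻ e) ≡ e
    X⁻-X    : ∀ e → X⁻ (X e) ≡ e
    T-T     : ∀ e → T (T e) ≡ e
    X-cong  : ∀ {e e′} → e ≈ e′ → X e ≈ X e′
    X⁻-cong : ∀ {e e′} → e ≈ e′ → X⁻ e ≈ X⁻ e′
    T-cong  : ∀ {e e′} → e ≈ e′ → T e ≈ T e′
    α-X     : ∀ e → α (X e) ≡ α e
    γ-YX    : ∀ e → γ (Y (X e)) ≡ γ e
    γ-X≢    : ∀ e → γ (X e) ≢ γ e
    at      : Fin n → Fin q → E
    α-at    : ∀ a f → α (at a f) ≡ a
    γ-at    : ∀ a f → γ (at a f) ≡ f
    X-orbit : ∀ e e′ → α e ≡ α e′ → ∃ λ k → iterate X k e ≈ e′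
    U-orbit : ∀ e e′ → γ e ≡ γ e′ → ∃ λ k → iterate (λ e → Y (X e)) k e ≈ e′
    L       : E → E → E → E
    L-cong  : ∀ {m m′ e e′} → e ≈ e′ → L m m′ e ≈ L m m′ e′
    L-X     : ∀ m m′ e → L m m′ (X e) ≡ X (L m m′ e)
    L-Y     : ∀ m m′ e → L m m′ (Y e) ≡ Y (L m m′ e)
    L-maps  : ∀ m m′ → L m m′ m ≡ m′
    L-L     : ∀ m m′ e → L m m′ (L m′ m e) ≡ e
    o h₁ m₁ h₂ m₂ : E
    mirror₁ : Mirror X X⁻ Y Y⁻ o h₁ m₁
    mirror₂ : Mirror X X⁻ Y Y⁻ o h₂ m₂
    agree    : h₁ ≈ h₂
    disagree : ¬ (m₁ ≈ m₂)

-- Incidence structure of the cosets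

module Construction {n q : ℕ} (𝓡 : Rotary n q) where
  open Rotary 𝓡

  ≈-refl : ∀ {e} → e ≈ e
  ≈-refl = refl , refl

  ≈-sym : ∀ {e e′} → e ≈ e′ → e′ ≈ e
  ≈-sym (p , r) = sym p , sym r

  ≡⇒≈ : ∀ {e e′} → e ≡ e′ → e ≈ e′
  ≡⇒≈ refl = ≈-refl

  -- The second vertex is the coset e⟨y⟩. Since `T` exchanges x and y, the labelling of the cosets
  -- of ⟨x⟩ serves again, read at `T e`.
  vl : Fin 2 → E → Fin n
  vl zero       e = α e
  vl (suc zero) e = α (T e)

  -- The two faces are e⟨xy⟩ and ex⁻¹⟨xy⟩. The turn `X` about the first vertex keeps the face `γ e`,
  -- but as the second face of the new edge.
  fl : Fin 2 → E → Fin q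
  fl zero       e = γ e
  fl (suc zero) e = γ (X⁻ e)

  vl-cong : ∀ s {e e′} → e ≈ e′ → vl s e ≡ vl s e′
  vl-cong zero       h = proj₁ h
  vl-cong (suc zero) h = proj₁ (T-cong h)

  fl-cong : ∀ t {e e′} → e ≈ e′ → fl t e ≡ fl t e′
  fl-cong zero       h = proj₂ h
  fl-cong (suc zero) h = proj₂ (X⁻-cong h)

  δ : E → Fin q
  δ = fl (suc zero)

  δ-X : ∀ e → δ (X e) ≡ γ e
  δ-X e = cong γ (X⁻-X e)

  γ-Y : ∀ e → γ (Y e) ≡ δ e
  γ-Y e = trans (cong (γ ∘ Y) (sym (X-X⁻ e))) (γ-YX (X⁻ e))

  Y-Y⁻ : ∀ e → Y (Y⁻ e) ≡ e
  Y-Y⁻ e = trans (cong (T ∘ X) (T-T _)) (trans (cong T (X-X⁻ _)) (T-T e))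

  δ-Y⁻ : ∀ e → δ (Y⁻ e) ≡ γ e
  δ-Y⁻ e = trans (sym (γ-Y (Y⁻ e))) (cong γ (Y-Y⁻ e))

  α-X⁻ : ∀ e → α (X⁻ e) ≡ α e
  α-X⁻ e = trans (sym (α-X (X⁻ e))) (cong α (X-X⁻ e))

  β-Y : ∀ e → α (T (Y e)) ≡ α (T e)
  β-Y e = trans (cong α (T-T _)) (α-X (T e))

  β-Y⁻ : ∀ e → α (T (Y⁻ e)) ≡ α (T e)
  β-Y⁻ e = trans (cong α (T-T _)) (α-X⁻ (T e))

  γ≢δ : ∀ e → γ e ≢ δ e
  γ≢δ e h = γ-X≢ (X⁻ e) (trans (cong γ (X-X⁻ e)) h)

  fl-injective : ∀ {s t e e′} → e ≈ e′ → fl s e ≡ fl t e′ → s ≡ t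
  fl-injective {zero}     {zero}     h r = refl
  fl-injective {zero}     {suc zero} h r = contradiction (trans (sym (proj₂ h)) r) (γ≢δ _)
  fl-injective {suc zero} {zero}     h r = contradiction (trans (proj₂ h) (sym r)) (γ≢δ _)
  fl-injective {suc zero} {suc zero} h r = refl

  -- `T` turns xy into yx = x⁻¹(xy)x, so it takes a coset of ⟨xy⟩ to a coset of the conjugate
  -- x⁻¹⟨xy⟩x, and `δ` is constant on these.
  δ-T : ∀ {e e′} → γ e ≡ γ e′ → δ (T e) ≡ δ (T e′)
  δ-T {e} {e′} h = let k , r = U-orbit e e′ h in
    trans (sym (along k e)) (fl-cong (suc zero) (T-cong r))
    where
    one : ∀ e → δ (T (Y (X e))) ≡ δ (T e)
    one e = begin
      δ (T (Y (X e)))     ≡⟨ cong δ (T-T _) ⟩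
      δ (X (T (X e)))     ≡⟨ δ-X _ ⟩
      γ (T (X e))         ≡⟨ cong (γ ∘ T ∘ X) (sym (T-T e)) ⟩
      γ (Y (T e))         ≡⟨ γ-Y (T e) ⟩
      δ (T e)             ∎
      where open ≡-Reasoning
    along : ∀ k e → δ (T (iterate (λ e → Y (X e)) k e)) ≡ δ (T e)
    along zero    e = refl
    along (suc k) e = trans (along k (Y (X e))) (one e)

  γ-T : ∀ {e e′} → δ e ≡ δ e′ → γ (T e) ≡ γ (T e′)
  γ-T {e} {e′} h = trans (sym (lem e)) (trans (δ-T h) (lem e′))
    where
    lem : ∀ e → δ (T (X⁻ e)) ≡ γ (T e)
    lem e = trans (cong (δ ∘ T ∘ X⁻) (sym (T-T e))) (δ-Y⁻ (T e))

  el : Fin 2 → Fin 2 → Fin n → Fin q → E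
  el zero       zero       a f = at a f
  el zero       (suc zero) a f = X (at a f)
  -- By `γ-T`, every element whose second face is f′ = `δ (T (at a f))` is taken by `T` to one whose
  -- first face is f. The element of vertex label a and first face f′ becomes such an element after
  -- `X`.
  el (suc zero) zero       a f = T (X (at a (δ (T (at a f)))))
  el (suc zero) (suc zero) a f = Y⁻ (el (suc zero) zero a f)

  vl-el : ∀ s t a f → vl s (el s t a f) ≡ a
  vl-el zero       zero       a f = α-at a f
  vl-el zero       (suc zero) a f = trans (α-X _) (α-at a f)
  vl-el (suc zero) zero       a f = trans (cong α (T-T _)) (trans (α-X _) (α-at a _))
  vl-el (suc zero) (suc zero) a f = trans (β-Y⁻ _) (vl-el (suc zero) zero a f)

  fl-el : ∀ s t a f → fl t (el s t a f) ≡ f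
  fl-el zero       zero       a f = γ-at a f
  fl-el zero       (suc zero) a f = trans (δ-X _) (γ-at a f)
  fl-el (suc zero) zero       a f =
    trans (γ-T (trans (δ-X _) (γ-at a _))) (trans (cong γ (T-T _)) (γ-at a f))
  fl-el (suc zero) (suc zero) a f = trans (δ-Y⁻ _) (fl-el (suc zero) zero a f)

  -- Tightness in group terms: a coset of ⟨x⟩ and a coset of ⟨xy⟩ share at most one element. This is
  -- built into `_≈_`; `X⁻` and `T` reduce the other choices of sides to it.
  unique : ∀ s t {e e′} → vl s e ≡ vl s e′ → fl t e ≡ fl t e′ → e ≈ e′
  unique zero zero v f = v , f
  unique zero (suc zero) {e} {e′} v f =
    subst₂ _≈_ (X-X⁻ e) (X-X⁻ e′) (X-cong (trans (α-X⁻ e) (trans v (sym (α-X⁻ e′))) , f))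
  unique (suc zero) zero {e} {e′} v f =
    subst₂ _≈_ (T-T e) (T-T e′) (T-cong (unique zero (suc zero) v (δ-T f)))
  unique (suc zero) (suc zero) {e} {e′} v f =
    subst₂ _≈_ (T-T e) (T-T e′) (T-cong (v , γ-T f))

  rep : Fin (n ℕ.* q) → E
  rep i = at (proj₁ (remQuot {n} q i)) (proj₂ (remQuot {n} q i))

  edge : E → Fin (n ℕ.* q)
  edge e = combine (α e) (γ e)

  edge-rep : ∀ i → edge (rep i) ≡ i
  edge-rep i = trans (cong₂ combine (α-at _ _) (γ-at _ _)) (combine-remQuot {n} q i)

  rep-edge : ∀ e → rep (edge e) ≈ e
  rep-edge e = trans (α-at _ _) (cong proj₁ (remQuot-combine (α e) (γ e)))
             , trans (γ-at _ _) (cong proj₂ (remQuot-combine (α e) (γ e)))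

  edge-cong : ∀ {e e′} → e ≈ e′ → edge e ≡ edge e′
  edge-cong (v , f) = cong₂ combine v f

  edge-injective : ∀ {e e′} → edge e ≡ edge e′ → e ≈ e′
  edge-injective {e} {e′} h = combine-injectiveˡ (α e) (γ e) (α e′) (γ e′) h
                            , combine-injectiveʳ (α e) (γ e) (α e′) (γ e′) h

  side : Fin (2 ℕ.* n) → Fin 2
  side v = proj₁ (remQuot {2} n v)

  label : Fin (2 ℕ.* n) → Fin n
  label v = proj₂ (remQuot {2} n v)

  vertex : Fin 2 → E → Fin (2 ℕ.* n)
  vertex s e = combine s (vl s e)

  side-vertex : ∀ s e → side (vertex s e) ≡ s
  side-vertex s e = cong proj₁ (remQuot-combine s (vl s e))

  label-vertex : ∀ s e → label (vertex s e) ≡ vl s e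
  label-vertex s e = cong proj₂ (remQuot-combine s (vl s e))

  poset : RankedPoset
  poset = record
    { nV = 2 ℕ.* n ; nE = n ℕ.* q ; nF = q
    ; VE = λ v i → does (vl (side v) (rep i) ≟ label v)
    ; EF = λ i f → does (γ (rep i) ≟ f) ∨ does (δ (rep i) ≟ f)
    -- Every vertex lies on every face, since `el` supplies an edge through any given pair.
    ; VF = λ _ _ → true }

  open RankedPoset poset hiding (nV; nE; nF)

  VE⇒ : ∀ v i → VE v i ≡ true → vl (side v) (rep i) ≡ label v
  VE⇒ v i h with vl (side v) (rep i) ≟ label v
  ... | yes r = r

  ⇒VE : ∀ v i → vl (side v) (rep i) ≡ label v → VE v i ≡ true
  ⇒VE v i r = dec-true (vl (side v) (rep i) ≟ label v) r

  VE⇒vertex : ∀ v i → VE v i ≡ true → vertex (side v) (rep i) ≡ v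
  VE⇒vertex v i h = trans (cong (combine (side v)) (VE⇒ v i h)) (combine-remQuot {2} n v)

  EF⇒ : ∀ i f → EF i f ≡ true → ∃ λ t → fl t (rep i) ≡ f
  EF⇒ i f h with γ (rep i) ≟ f | δ (rep i) ≟ f
  ... | yes r | _     = zero , r
  ... | no _  | yes r = suc zero , r

  ⇒EF : ∀ i f t → fl t (rep i) ≡ f → EF i f ≡ true
  ⇒EF i f zero r with γ (rep i) ≟ f
  ... | yes _ = refl
  ... | no ¬r = contradiction r ¬r
  ⇒EF i f (suc zero) r with γ (rep i) ≟ f | δ (rep i) ≟ f
  ... | yes _ | _     = refl
  ... | no _  | yes _ = refl
  ... | no _  | no ¬r = contradiction r ¬r

  VE-edge : ∀ v e → vl (side v) e ≡ label v → VE v (edge e) ≡ true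
  VE-edge v e r = ⇒VE v (edge e) (trans (vl-cong (side v) (rep-edge e)) r)

  EF-edge : ∀ e f t → fl t e ≡ f → EF (edge e) f ≡ true
  EF-edge e f t r = ⇒EF (edge e) f t (trans (fl-cong t (rep-edge e)) r)

  VE-vertex : ∀ s e → VE (vertex s e) (edge e) ≡ true
  VE-vertex s e = VE-edge (vertex s e) e
    (trans (cong (λ r → vl r e) (side-vertex s e)) (sym (label-vertex s e)))

  VE-vertex-rep : ∀ s i → VE (vertex s (rep i)) i ≡ true
  VE-vertex-rep s i = subst (λ j → VE (vertex s (rep i)) j ≡ true) (edge-rep i) (VE-vertex s (rep i))

  edge-2V : ∀ i → countF (2 ℕ.* n) (λ v → VE v i) ≡ 2
  edge-2V i = countF-bijection _ (λ s → vertex s (rep i))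
    (λ h → combine-injectiveˡ _ _ _ _ h)
    (λ s → VE-vertex-rep s i)
    (λ v h → side v , VE⇒vertex v i h)

  edge-2F : ∀ i → countF q (λ f → EF i f) ≡ 2
  edge-2F i = countF-bijection _ (λ t → fl t (rep i))
    (λ h → fl-injective ≈-refl h) (λ t → ⇒EF i _ t refl) (λ f h → EF⇒ i f h)

  diamond : ∀ v f → countF (n ℕ.* q) (λ i → VE v i ∧ EF i f) ≡ 2
  diamond v f = countF-bijection _ (λ t → edge (el (side v) t (label v) f))
    (λ {s} {t} h → fl-injective (edge-injective h)
      (trans (fl-el (side v) s (label v) f) (sym (fl-el (side v) t (label v) f))))
    (λ t → ∧-true (VE-edge v _ (vl-el (side v) t _ f)) (EF-edge _ f t (fl-el (side v) t _ f)))
    (λ i h → let t , r = EF⇒ i f (∧-trueʳ h) in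
      t , trans (edge-cong (unique (side v) t
            (trans (vl-el (side v) t _ f) (sym (VE⇒ v i (∧-trueˡ h))))
            (trans (fl-el (side v) t _ f) (sym r)))) (edge-rep i))

  face-edges : ∀ f → countF (n ℕ.* q) (λ i → EF i f) ≡ 2 ℕ.* n
  -- The index set 2n is the set of vertices, but `side v` is used as the side on which f lies; the
  -- first vertex of the edge supplies the label.
  face-edges f = countF-bijection _ (λ v → edge (el zero (side v) (label v) f))
    (λ {v} {w} h → subst₂ _≡_ (combine-remQuot {2} n v) (combine-remQuot {2} n w)
      (cong₂ combine
        (fl-injective {side v} {side w} (edge-injective h)
          (trans (fl-el zero (side v) (label v) f) (sym (fl-el zero (side w) (label w) f))))
        (trans (sym (vl-el zero (side v) (label v) f))
          (trans (vl-cong zero (edge-injective h)) (vl-el zero (side w) (label w) f)))))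
    (λ v → EF-edge _ f (side v) (fl-el zero (side v) _ f))
    (λ i h → let t , r = EF⇒ i f h ; v = combine t (α (rep i))
                 s≡ = cong proj₁ (remQuot-combine t (α (rep i)))
                 l≡ = cong proj₂ (remQuot-combine t (α (rep i))) in
      v , trans (edge-cong (unique zero (side v)
            (trans (vl-el zero (side v) _ f) l≡)
            (trans (fl-el zero (side v) _ f) (trans (sym r) (cong (λ t → fl t (rep i)) (sym s≡))))))
          (edge-rep i))

  vertex-edges : ∀ v → countF (n ℕ.* q) (λ i → VE v i) ≡ q
  vertex-edges v = countF-bijection _ (λ f → edge (el (side v) zero (label v) f))
    (λ {f} {g} h → trans (sym (fl-el (side v) zero _ f))
      (trans (fl-cong zero (edge-injective h)) (fl-el (side v) zero _ g)))
    (λ f → VE-edge v _ (vl-el (side v) zero _ f))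
    (λ i h → γ (rep i) , trans (edge-cong (unique (side v) zero
        (trans (vl-el (side v) zero _ _) (sym (VE⇒ v i h))) (fl-el (side v) zero _ _)))
      (edge-rep i))

  turn turn⁻ : Fin 2 → E → E
  turn zero        = X
  turn (suc zero)  = Y
  turn⁻ zero       = X⁻
  turn⁻ (suc zero) = Y⁻

  vl-turn : ∀ s e → vl s (turn s e) ≡ vl s e
  vl-turn zero       e = α-X e
  vl-turn (suc zero) e = β-Y e

  fl-turn : ∀ s e → fl (flip s) (turn s e) ≡ fl s e
  fl-turn zero       e = δ-X e
  fl-turn (suc zero) e = γ-Y e

  vl-turn⁻ : ∀ s e → vl s (turn⁻ s e) ≡ vl s e
  vl-turn⁻ zero       e = α-X⁻ e
  vl-turn⁻ (suc zero) e = β-Y⁻ e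

  fl-turn⁻ : ∀ s e → fl s (turn⁻ s e) ≡ fl (flip s) e
  fl-turn⁻ zero       e = refl
  fl-turn⁻ (suc zero) e = δ-Y⁻ e

  iterate-Y : ∀ k e → iterate Y k e ≡ T (iterate X k (T e))
  iterate-Y zero    e = sym (T-T e)
  iterate-Y (suc k) e = trans (iterate-Y k (Y e)) (cong (T ∘ iterate X k) (T-T _))

  orbit : ∀ s e e′ → vl s e ≡ vl s e′ → ∃ λ k → iterate (turn s) k e ≈ e′
  orbit zero       e e′ h = X-orbit e e′ h
  orbit (suc zero) e e′ h = let k , r = X-orbit (T e) (T e′) h in
    k , subst₂ _≈_ (sym (iterate-Y k e)) (T-T e′) (T-cong r)

  V′ : Fin (2 ℕ.* n) → Elem
  V′ v = inj₁ v

  E′ : Fin (n ℕ.* q) → Elem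
  E′ i = inj₂ (inj₁ i)

  F′ : Fin q → Elem
  F′ f = inj₂ (inj₂ f)

  connected : ConnectedOn (λ _ → true) inc
  connected x y _ _ = from x (to y)
    where
    v₀ : Fin (2 ℕ.* n)
    v₀ = vertex zero o
    f₀ : Fin q
    f₀ = γ o
    from : ∀ x → PathIn (λ _ → true) inc (V′ v₀) y → PathIn (λ _ → true) inc x y
    from (inj₁ v)        π = step {y = F′ f₀} refl refl (step refl refl π)
    from (inj₂ (inj₁ i)) π = step {y = F′ (γ (rep i))} (⇒EF i _ zero refl) refl (step refl refl π)
    from (inj₂ (inj₂ f)) π = step refl refl π
    to : ∀ y → PathIn (λ _ → true) inc (V′ v₀) y
    to (inj₁ v)        = step {y = F′ f₀} refl refl (step refl refl here)
    to (inj₂ (inj₁ i)) = step {y = F′ (γ (rep i))} refl refl (step (⇒EF i _ zero refl) refl here)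
    to (inj₂ (inj₂ f)) = step refl refl here

  module _ (v : Fin (2 ℕ.* n)) where
    private
      At : E → Set
      At e = vl (side v) e ≡ label v

      Link : Elem → Elem → Set
      Link = PathIn (inc (V′ v)) inc

      via : ∀ {z} e e′ → At e′ → ∀ t t′ → fl t e ≡ fl t′ e′ →
            Link (E′ (edge e′)) z → Link (E′ (edge e)) z
      via e e′ a t t′ r π = step {y = F′ (fl t e)} (EF-edge e _ t refl) refl
        (step (EF-edge e′ _ t′ (sym r)) (VE-edge v e′ a) π)

      walk : ∀ {z} k e e′ → At e → iterate (turn (side v)) k e ≈ e′ →
             Link (E′ (edge e′)) z → Link (E′ (edge e)) z
      walk {z} zero    e e′ a r π = subst (λ i → Link (E′ i) z) (sym (edge-cong r)) π
      walk {z} (suc k) e e′ a r π = via e _ a′ (side v) (flip (side v)) (sym (fl-turn (side v) e))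
        (walk k _ e′ a′ r π)
        where a′ = trans (vl-turn (side v) e) a

      between : ∀ {z} i j → VE v i ≡ true → VE v j ≡ true → Link (E′ j) z → Link (E′ i) z
      between {z} i j hi hj π =
        let k , r = orbit (side v) (rep i) (rep j) (trans (VE⇒ v i hi) (sym (VE⇒ v j hj))) in
        subst (λ i → Link (E′ i) z) (edge-rep i) (walk k (rep i) (rep j) (VE⇒ v i hi) r
          (subst (λ j → Link (E′ j) z) (sym (edge-rep j)) π))

      spoke : Fin q → E
      spoke f = el (side v) zero (label v) f

      spoke-VE : ∀ f → VE v (edge (spoke f)) ≡ true
      spoke-VE f = VE-edge v (spoke f) (vl-el (side v) zero (label v) f)

      spoke-EF : ∀ f → EF (edge (spoke f)) f ≡ true
      spoke-EF f = EF-edge (spoke f) f zero (fl-el (side v) zero (label v) f)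

    vertex-link : ConnectedOn (inc (V′ v)) inc
    vertex-link (inj₂ (inj₁ i)) (inj₂ (inj₁ j)) hi hj = between i j hi hj here
    vertex-link (inj₂ (inj₁ i)) (inj₂ (inj₂ g)) hi hj =
      between i _ hi (spoke-VE g) (step (spoke-EF g) refl here)
    vertex-link (inj₂ (inj₂ f)) (inj₂ (inj₁ j)) hi hj =
      step (spoke-EF f) (spoke-VE f) (between _ j (spoke-VE f) hj here)
    vertex-link (inj₂ (inj₂ f)) (inj₂ (inj₂ g)) hi hj =
      step (spoke-EF f) (spoke-VE f) (between _ _ (spoke-VE f) (spoke-VE g) (step (spoke-EF g) refl here))

  module _ (f : Fin q) where
    private
      Link : Elem → Elem → Set
      Link = PathIn (inc (F′ f)) inc

      via : ∀ {z} s e e′ t → fl t e′ ≡ f → vl s e ≡ vl s e′ →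
            Link (E′ (edge e′)) z → Link (E′ (edge e)) z
      via s e e′ t a r π = step {y = V′ (vertex s e)} (VE-vertex s e) refl
        (step (subst (λ v → VE v (edge e′) ≡ true) (cong (combine s) (sym r)) (VE-vertex s e′))
          (EF-edge e′ f t a) π)

      walk : ∀ {z} k e e′ → γ e ≡ f → iterate (λ e → Y (X e)) k e ≈ e′ →
             Link (E′ (edge e′)) z → Link (E′ (edge e)) z
      walk {z} zero    e e′ a r π = subst (λ i → Link (E′ i) z) (sym (edge-cong r)) π
      walk {z} (suc k) e e′ a r π =
        -- One step of u along the boundary of f passes two edges: e and `X e` share e⟨x⟩, then
        -- `X e` and `Y (X e)` share the second vertex of `X e`. The face f is on the second side of
        -- the middle edge.
        via zero e (X e) (suc zero) (trans (δ-X e) a) (sym (α-X e))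
          (via (suc zero) (X e) (Y (X e)) zero a′ (sym (β-Y (X e))) (walk k _ e′ a′ r π))
        where a′ = trans (γ-YX e) a

      straighten : Fin 2 → E → E
      straighten zero       e = e
      straighten (suc zero) e = X⁻ e

      γ-straighten : ∀ t e → γ (straighten t e) ≡ fl t e
      γ-straighten zero       e = refl
      γ-straighten (suc zero) e = refl

      into : ∀ {z} t e → fl t e ≡ f → Link (E′ (edge (straighten t e))) z → Link (E′ (edge e)) z
      into zero       e a π = π
      into (suc zero) e a π = via zero e (X⁻ e) zero a (sym (α-X⁻ e)) π

      outof : ∀ {z} t e → fl t e ≡ f → Link (E′ (edge e)) z → Link (E′ (edge (straighten t e))) z
      outof zero       e a π = π
      outof (suc zero) e a π = via zero (X⁻ e) e (suc zero) a (α-X⁻ e) π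

      between : ∀ {z} i j → EF i f ≡ true → EF j f ≡ true → Link (E′ j) z → Link (E′ i) z
      between {z} i j hi hj π =
        let t  , a  = EF⇒ i f hi
            t′ , a′ = EF⇒ j f hj
            b  = trans (γ-straighten t (rep i)) a
            b′ = trans (γ-straighten t′ (rep j)) a′
            k , r = U-orbit _ _ (trans b (sym b′)) in
        subst (λ i → Link (E′ i) z) (edge-rep i) (into t (rep i) a (walk k _ _ b r
          (outof t′ (rep j) a′ (subst (λ j → Link (E′ j) z) (sym (edge-rep j)) π))))

      spoke : Fin (2 ℕ.* n) → E
      spoke v = el (side v) zero (label v) f

      spoke-VE : ∀ v → VE v (edge (spoke v)) ≡ true
      spoke-VE v = VE-edge v (spoke v) (vl-el (side v) zero (label v) f)

      spoke-EF : ∀ v → EF (edge (spoke v)) f ≡ true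
      spoke-EF v = EF-edge (spoke v) f zero (fl-el (side v) zero (label v) f)

    face-link : ConnectedOn (inc (F′ f)) inc
    face-link (inj₂ (inj₁ i)) (inj₂ (inj₁ j)) hi hj = between i j hi hj here
    face-link (inj₂ (inj₁ i)) (inj₁ w) hi hj =
      between i _ hi (spoke-EF w) (step (spoke-VE w) refl here)
    face-link (inj₁ v) (inj₂ (inj₁ j)) hi hj =
      step (spoke-VE v) (spoke-EF v) (between _ j (spoke-EF v) hj here)
    face-link (inj₁ v) (inj₁ w) hi hj =
      step (spoke-VE v) (spoke-EF v) (between _ _ (spoke-EF v) (spoke-EF w) (step (spoke-VE w) refl here))

  isPolyhedron : IsPolyhedron
  isPolyhedron = record
    { trans-VEF = λ _ _ _ _ _ → refl ; edge-2V = edge-2V ; edge-2F = edge-2F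
    ; diamond = λ v f _ → diamond v f ; connected = connected
    ; vertex-link = vertex-link ; face-link = face-link }

  -- Automorphisms from translations and the half-turn

  -- π is the identity for left translations, while the half-turn T exchanges both the two vertices and
  -- the two faces of an edge.
  record Hom : Set where
    field
      g      : E → E
      π      : Fin 2 → Fin 2
      g-vl   : ∀ s {e e′} → vl s e ≡ vl s e′ → vl (π s) (g e) ≡ vl (π s) (g e′)
      g-fl   : ∀ t t′ {e e′} → fl t e ≡ fl t′ e′ → fl (π t) (g e) ≡ fl (π t′) (g e′)

    g-cong : ∀ {e e′} → e ≈ e′ → g e ≈ g e′
    g-cong (v , f) = unique (π zero) (π zero) (g-vl zero v) (g-fl zero zero f)

    gV : Fin (2 ℕ.* n) → Fin (2 ℕ.* n)
    gV v = vertex (π (side v)) (g (el (side v) zero (label v) (γ o)))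

    gE : Fin (n ℕ.* q) → Fin (n ℕ.* q)
    gE i = edge (g (rep i))

    gF : Fin q → Fin q
    gF f = fl (π zero) (g (at (α o) f))

    gV-vertex : ∀ s e → gV (vertex s e) ≡ vertex (π s) (g e)
    gV-vertex s e = trans
      (cong₂ (λ s a → vertex (π s) (g (el s zero a (γ o)))) (side-vertex s e) (label-vertex s e))
      (cong (combine (π s)) (g-vl s (vl-el s zero _ _)))

    gE-edge : ∀ e → gE (edge e) ≡ edge (g e)
    gE-edge e = edge-cong (g-cong (rep-edge e))

    gF-fl : ∀ t e → gF (fl t e) ≡ fl (π t) (g e)
    gF-fl t e = g-fl zero t (γ-at _ _)

    gVE : ∀ v i → VE v i ≡ true → VE (gV v) (gE i) ≡ true
    gVE v i h = subst (λ v → VE v (gE i) ≡ true)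
      (trans (sym (gV-vertex (side v) (rep i))) (cong gV (VE⇒vertex v i h)))
      (VE-vertex (π (side v)) (g (rep i)))

    gEF : ∀ i f → EF i f ≡ true → EF (gE i) (gF f) ≡ true
    gEF i f h = let t , r = EF⇒ i f h in
      EF-edge (g (rep i)) (gF f) (π t) (trans (sym (gF-fl t (rep i))) (cong gF r))

  module _ (G H : Hom) (πH-πG : ∀ s → Hom.π H (Hom.π G s) ≡ s) (H-G : ∀ e → Hom.g H (Hom.g G e) ≡ e) where
    private
      module G = Hom G
      module H = Hom H

    V-inverse : ∀ v → H.gV (G.gV v) ≡ v
    V-inverse v = begin
      H.gV (G.gV v)                          ≡⟨ H.gV-vertex _ _ ⟩
      vertex (H.π (G.π (side v))) (H.g (G.g e)) ≡⟨ cong₂ vertex (πH-πG (side v)) (H-G e) ⟩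
      vertex (side v) e                      ≡⟨ cong (combine (side v)) (vl-el (side v) zero (label v) (γ o)) ⟩
      combine (side v) (label v)             ≡⟨ combine-remQuot {2} n v ⟩
      v                                      ∎
      where
      open ≡-Reasoning
      e = el (side v) zero (label v) (γ o)

    E-inverse : ∀ i → H.gE (G.gE i) ≡ i
    E-inverse i = trans (H.gE-edge _) (trans (cong edge (H-G (rep i))) (edge-rep i))

    F-inverse : ∀ f → H.gF (G.gF f) ≡ f
    F-inverse f = trans (H.gF-fl _ _) (trans (cong₂ fl (πH-πG zero) (H-G (at (α o) f))) (γ-at (α o) f))

  record Sym : Set where
    field
      G H   : Hom
      π-HG  : ∀ s → Hom.π H (Hom.π G s) ≡ s
      π-GH  : ∀ s → Hom.π G (Hom.π H s) ≡ s
      HG    : ∀ e → Hom.g H (Hom.g G e) ≡ e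
      GH    : ∀ e → Hom.g G (Hom.g H e) ≡ e

    open Hom G public

  automorphism : Sym → Automorphism
  automorphism S = record
    { σV = permutation G.gV H.gV (V-inverse H G π-GH GH) (V-inverse G H π-HG HG)
    ; σE = permutation G.gE H.gE (E-inverse H G π-GH GH) (E-inverse G H π-HG HG)
    ; σF = permutation G.gF H.gF (F-inverse H G π-GH GH) (F-inverse G H π-HG HG)
    ; pres-VE = λ v i → iff⇒≡ (λ h → subst₂ (λ v i → VE v i ≡ true)
        (V-inverse G H π-HG HG v) (E-inverse G H π-HG HG i) (H.gVE _ _ h)) (G.gVE v i)
    ; pres-EF = λ i f → iff⇒≡ (λ h → subst₂ (λ i f → EF i f ≡ true)
        (E-inverse G H π-HG HG i) (F-inverse G H π-HG HG f) (H.gEF _ _ h)) (G.gEF i f)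
    ; pres-VF = λ _ _ → refl }
    where
    open Sym S using (π-GH; π-HG; GH; HG) renaming (G to 𝓖; H to 𝓗)
    G = 𝓖
    H = 𝓗
    module G = Hom G
    module H = Hom H
    iff⇒≡ : ∀ {a b} → (a ≡ true → b ≡ true) → (b ≡ true → a ≡ true) → a ≡ b
    iff⇒≡ {true}  {b}     h k = sym (h refl)
    iff⇒≡ {false} {true}  h k = k refl
    iff⇒≡ {false} {false} h k = refl

  invariant-orbit : ∀ {A : Set} (t : E → A) {f : E → E} → (∀ e → t (f e) ≡ t e) →
    ∀ k e → t (iterate f k e) ≡ t e
  invariant-orbit t h zero    e = refl
  invariant-orbit t h (suc k) e = trans (invariant-orbit t h k _) (h e)

  -- Left multiplication commutes with right multiplication by x and y. Equal labels mean a common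
  -- orbit of such right multiplications, so equality of labels is preserved.
  translation-Hom : E → E → Hom
  translation-Hom m m′ = record { g = L m m′ ; π = id ; g-vl = g-vl ; g-fl = g-fl }
    where
    l = L m m′
    l-X⁻ : ∀ e → l (X⁻ e) ≡ X⁻ (l e)
    l-X⁻ e = trans (sym (X⁻-X _)) (cong X⁻ (trans (sym (L-X m m′ (X⁻ e))) (cong l (X-X⁻ e))))
    l-turn : ∀ s e → vl s (l (turn s e)) ≡ vl s (l e)
    l-turn zero       e = trans (cong α (L-X m m′ e)) (α-X (l e))
    l-turn (suc zero) e = trans (cong (α ∘ T) (L-Y m m′ e)) (β-Y (l e))
    g-vl : ∀ s {e e′} → vl s e ≡ vl s e′ → vl s (l e) ≡ vl s (l e′)
    g-vl s {e} {e′} h = let k , r = orbit s e e′ h in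
      trans (sym (invariant-orbit (vl s ∘ l) (l-turn s) k e)) (vl-cong s (L-cong r))
    g-γ : ∀ {e e′} → γ e ≡ γ e′ → γ (l e) ≡ γ (l e′)
    g-γ {e} {e′} h = let k , r = U-orbit e e′ h in
      trans (sym (invariant-orbit (γ ∘ l) (λ e → trans (cong γ (trans (L-Y m m′ (X e)) (cong Y (L-X m m′ e)))) (γ-YX (l e))) k e))
        (proj₂ (L-cong r))
    base-of : Fin 2 → E → E
    base-of zero       e = e
    base-of (suc zero) e = X⁻ e
    fl-base : ∀ t e → fl t e ≡ γ (base-of t e)
    fl-base zero       e = refl
    fl-base (suc zero) e = refl
    fl-l : ∀ t e → fl t (l e) ≡ γ (l (base-of t e))
    fl-l zero       e = refl
    fl-l (suc zero) e = cong γ (sym (l-X⁻ e))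
    g-fl : ∀ t t′ {e e′} → fl t e ≡ fl t′ e′ → fl t (l e) ≡ fl t′ (l e′)
    g-fl t t′ {e} {e′} h = trans (fl-l t e)
      (trans (g-γ (trans (sym (fl-base t e)) (trans h (fl-base t′ e′)))) (sym (fl-l t′ e′)))

  translation : E → E → Sym
  translation m m′ = record
    { G = translation-Hom m m′ ; H = translation-Hom m′ m
    ; π-HG = λ _ → refl ; π-GH = λ _ → refl ; HG = L-L m′ m ; GH = L-L m m′ }

  half-turn-Hom : Hom
  half-turn-Hom = record { g = T ; π = flip ; g-vl = g-vl ; g-fl = g-fl }
    where
    g-vl : ∀ s {e e′} → vl s e ≡ vl s e′ → vl (flip s) (T e) ≡ vl (flip s) (T e′)
    g-vl zero       h = trans (cong α (T-T _)) (trans h (cong α (sym (T-T _))))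
    g-vl (suc zero) h = h
    γ-T-δ : ∀ e → γ (T e) ≡ δ (T (X⁻ e))
    γ-T-δ e = trans (sym (δ-Y⁻ (T e))) (cong (δ ∘ T ∘ X⁻) (T-T e))
    g-fl : ∀ t t′ {e e′} → fl t e ≡ fl t′ e′ → fl (flip t) (T e) ≡ fl (flip t′) (T e′)
    g-fl zero       zero       h = δ-T h
    g-fl zero       (suc zero) h = trans (δ-T h) (sym (γ-T-δ _))
    g-fl (suc zero) zero       h = trans (γ-T-δ _) (δ-T h)
    g-fl (suc zero) (suc zero) h = γ-T h

  half-turn : Sym
  half-turn = record
    { G = half-turn-Hom ; H = half-turn-Hom
    ; π-HG = flip-involutive ; π-GH = flip-involutive ; HG = T-T ; GH = T-T }

  compose-Hom : Hom → Hom → Hom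
  compose-Hom G H = record
    { g = λ e → H.g (G.g e) ; π = λ s → H.π (G.π s)
    ; g-vl = λ s h → H.g-vl (G.π s) (G.g-vl s h)
    ; g-fl = λ t t′ h → H.g-fl (G.π t) (G.π t′) (G.g-fl t t′ h) }
    where
    module G = Hom G
    module H = Hom H

  compose : Sym → Sym → Sym
  compose S R = record
    { G = compose-Hom S.G R.G ; H = compose-Hom R.H S.H
    ; π-HG = λ s → trans (cong (Hom.π S.H) (R.π-HG _)) (S.π-HG s)
    ; π-GH = λ s → trans (cong (Hom.π R.G) (S.π-GH _)) (R.π-GH s)
    ; HG = λ e → trans (cong (Hom.g S.H) (R.HG _)) (S.HG e)
    ; GH = λ e → trans (cong (Hom.g R.G) (S.GH _)) (R.GH e) }
    where
    module S = Sym S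
    module R = Sym R

  -- The two classes of flags

  open Flag

  faceSide : Flag → Fin 2
  faceSide (flag v i f h) = proj₁ (EF⇒ i f (∧-trueˡ (∧-trueʳ {VE v i} h)))

  vertexSide : Flag → Fin 2
  vertexSide Φ = side (fv Φ)

  fv-flag : ∀ Φ → vertex (vertexSide Φ) (rep (fe Φ)) ≡ fv Φ
  fv-flag (flag v i f h) = VE⇒vertex v i (∧-trueˡ h)

  ff-flag : ∀ Φ → fl (faceSide Φ) (rep (fe Φ)) ≡ ff Φ
  ff-flag (flag v i f h) = proj₂ (EF⇒ i f (∧-trueˡ (∧-trueʳ {VE v i} h)))

  colour : Flag → Bool
  colour Φ = does (vertexSide Φ ≟ faceSide Φ)

  moves : (S : Sym) (Φ Ψ : Flag) → Sym.g S (rep (fe Φ)) ≡ rep (fe Ψ) →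
    Sym.π S (vertexSide Φ) ≡ vertexSide Ψ → Sym.π S (faceSide Φ) ≡ faceSide Ψ →
    Σ Automorphism λ a → Automorphism.Maps a Φ Ψ
  moves S Φ Ψ h hv hf = automorphism S
    , trans (cong S.gV (sym (fv-flag Φ))) (trans (S.gV-vertex _ _) (trans (cong₂ vertex hv h) (fv-flag Ψ)))
    , trans (cong edge h) (edge-rep (fe Ψ))
    , trans (cong S.gF (sym (ff-flag Φ))) (trans (S.gF-fl _ _) (trans (cong₂ fl hf h) (ff-flag Ψ)))
    where module S = Sym S

  -- Two flags of one colour differ in both sides or in neither. Translations reach every edge and
  -- keep sides, while the half-turn exchanges both.
  transitive : ∀ Φ Ψ → colour Φ ≡ colour Ψ → Σ Automorphism λ a → Automorphism.Maps a Φ Ψ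
  transitive Φ Ψ h with vertexSide Φ ≟ vertexSide Ψ | faceSide Φ ≟ faceSide Ψ
  ... | yes v | yes f = moves (translation (rep (fe Φ)) (rep (fe Ψ))) Φ Ψ (L-maps _ _) v f
  ... | no  v | no  f = moves (compose half-turn (translation (T (rep (fe Φ))) (rep (fe Ψ)))) Φ Ψ
                              (L-maps _ _) (sym (≢⇒flip (v ∘ sym))) (sym (≢⇒flip (f ∘ sym)))
  ... | yes v | no  f = contradiction h (≟-changesʳ (vertexSide Φ) (faceSide Φ) (vertexSide Ψ) (faceSide Ψ) v f)
  ... | no  v | yes f = contradiction h (≟-changesˡ (vertexSide Φ) (faceSide Φ) (vertexSide Ψ) (faceSide Ψ) v f)

  alternating : ∀ i Φ Ψ → Adj i Φ Ψ → colour Φ ≢ colour Ψ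
  alternating zero Φ Ψ (v , e , f) = ≟-changesˡ (vertexSide Φ) (faceSide Φ) (vertexSide Ψ) (faceSide Ψ)
    (λ h → v (trans (sym (fv-flag Φ)) (trans (cong₂ vertex h (cong rep e)) (fv-flag Ψ))))
    (fl-injective {faceSide Φ} {faceSide Ψ} (≡⇒≈ (cong rep e)) (trans (ff-flag Φ) (trans f (sym (ff-flag Ψ)))))
  alternating (suc zero) Φ Ψ (v , e , f) = ≟-changesʳ (vertexSide Φ) (faceSide Φ) (vertexSide Ψ) (faceSide Ψ) (cong side v)
    (λ h → e (trans (sym (edge-rep _)) (trans
      (edge-cong (unique (vertexSide Ψ) (faceSide Ψ)
        (trans (cong (λ s → vl s (rep (fe Φ))) (cong side (sym v)))
          (trans (VE⇒ _ _ (∧-trueˡ (isFlag Φ)))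
            (trans (cong label v) (sym (VE⇒ _ _ (∧-trueˡ (isFlag Ψ)))))))
        (trans (cong (λ t → fl t (rep (fe Φ))) (sym h)) (trans (ff-flag Φ) (trans f (sym (ff-flag Ψ)))))))
      (edge-rep _))))
  alternating (suc (suc _)) Φ Ψ (v , e , f) = ≟-changesʳ (vertexSide Φ) (faceSide Φ) (vertexSide Ψ) (faceSide Ψ) (cong side v)
    (λ h → f (trans (sym (ff-flag Φ)) (trans (cong₂ fl h (cong rep e)) (ff-flag Ψ))))

  toFlag : Fin 2 → Fin 2 → E → Flag
  toFlag s t e = flag (vertex s e) (edge e) (fl t e)
    (∧-true (VE-vertex s e) (∧-true (EF-edge e (fl t e) t refl) refl))

  -- Impossibility of a reflection

  module _ (ρ : Automorphism) where
    open Automorphism ρ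

    private
      injective : ∀ {k} (σ : Permutation′ k) {i j} → σ ⟨$⟩ʳ i ≡ σ ⟨$⟩ʳ j → i ≡ j
      injective σ h = trans (sym (inverseˡ σ)) (trans (cong (σ ⟨$⟩ˡ_) h) (inverseˡ σ))

      vertex-of : ∀ v e → VE v (edge e) ≡ true → vertex (side v) e ≡ v
      vertex-of v e h = trans (cong (combine (side v)) (vl-cong (side v) (≈-sym (rep-edge e))))
        (VE⇒vertex v (edge e) h)

      face-of : ∀ e f → EF (edge e) f ≡ true → ∃ λ t → fl t e ≡ f
      face-of e f h = let t , r = EF⇒ (edge e) f h in t , trans (fl-cong t (≈-sym (rep-edge e))) r

    -- The invariant carried along a word: like a reflection that fixes the base edge and its
    -- vertices, ρ keeps the sides of vertices and exchanges those of faces.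
    record Reverses (h m : E) : Set where
      field
        onE : σE ⟨$⟩ʳ edge h ≡ edge m
        onV : ∀ s → σV ⟨$⟩ʳ vertex s h ≡ vertex s m
        onF : ∀ t → σF ⟨$⟩ʳ fl t h ≡ fl (flip t) m

    -- One vertex and one face of an edge determine the images of the others.
    reverses : ∀ {h m} s t → σE ⟨$⟩ʳ edge h ≡ edge m → σV ⟨$⟩ʳ vertex s h ≡ vertex s m →
      σF ⟨$⟩ʳ fl t h ≡ fl (flip t) m → Reverses h m
    reverses {h} {m} s t hE hV hF = record { onE = hE ; onV = onV ; onF = onF }
      where
      onV : ∀ r → σV ⟨$⟩ʳ vertex r h ≡ vertex r m
      onV r with r ≟ s
      ... | yes refl = hV
      ... | no  r≢s  = trans (sym image) (cong (λ s → vertex s m) (trans (≢⇒flip side≢) (sym (≢⇒flip r≢s))))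
        where
        w = σV ⟨$⟩ʳ vertex r h
        image : vertex (side w) m ≡ w
        image = vertex-of w m (subst (λ i → VE w i ≡ true) hE
          (trans (pres-VE (vertex r h) (edge h)) (VE-vertex r h)))
        side≢ : side w ≢ s
        side≢ q = r≢s (combine-injectiveˡ r (vl r h) s (vl s h)
          (injective σV (trans (sym image) (trans (cong (λ s → vertex s m) q) (sym hV)))))
      onF : ∀ r → σF ⟨$⟩ʳ fl r h ≡ fl (flip r) m
      onF r with r ≟ t
      ... | yes refl = hF
      ... | no  r≢t  = trans (sym (proj₂ image)) (cong (λ t → fl t m)
          (trans (≢⇒flip t≢) (cong flip (sym (≢⇒flip r≢t)))))
        where
        g = σF ⟨$⟩ʳ fl r h
        image : ∃ λ t → fl t m ≡ g
        image = face-of m g (subst (λ i → EF i g ≡ true) hE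
          (trans (pres-EF (edge h) (fl r h)) (EF-edge h (fl r h) r refl)))
        t≢ : proj₁ image ≢ flip t
        t≢ q = r≢t (fl-injective {e = h} ≈-refl
          (injective σF (trans (sym (proj₂ image)) (trans (cong (λ t → fl t m) q) (sym hF)))))

    -- `turn s h` shares with h the vertex of side s and the face `fl s h`. Its image lies on the
    -- images of both, and only m and `turn⁻ s m` do. Injectivity excludes m.
    reverses-turn : ∀ s {h m} → Reverses h m → Reverses (turn s h) (turn⁻ s m)
    reverses-turn s {h} {m} R = reverses s (flip s) onEdge
        (trans (cong (σV ⟨$⟩ʳ_) same-vertex) (trans (onV s) (cong (combine s) (sym (vl-turn⁻ s m)))))
        (trans (cong (σF ⟨$⟩ʳ_) (fl-turn s h)) (trans (onF s)
          (trans (sym (fl-turn⁻ s m)) (cong (λ t → fl t (turn⁻ s m)) (sym (flip-involutive s))))))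
      where
      open Reverses R
      k = rep (σE ⟨$⟩ʳ edge (turn s h))
      same-vertex : vertex s (turn s h) ≡ vertex s h
      same-vertex = cong (combine s) (vl-turn s h)
      k-V : vl s k ≡ vl s m
      k-V = combine-injectiveʳ s _ s _ (trans (cong (λ r → combine r (vl r k)) (sym side≡))
        (VE⇒vertex (vertex s m) (σE ⟨$⟩ʳ edge (turn s h))
          (subst (λ v → VE v (σE ⟨$⟩ʳ edge (turn s h)) ≡ true)
            (trans (cong (σV ⟨$⟩ʳ_) same-vertex) (onV s))
            (trans (pres-VE _ _) (VE-vertex s (turn s h))))))
        where
        side≡ = side-vertex s m
      k-F : ∃ λ t → fl t k ≡ fl (flip s) m
      k-F = EF⇒ (σE ⟨$⟩ʳ edge (turn s h)) (fl (flip s) m)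
        (subst (λ f → EF (σE ⟨$⟩ʳ edge (turn s h)) f ≡ true) (onF s)
          (trans (pres-EF _ _) (EF-edge (turn s h) (fl s h) (flip s) (fl-turn s h))))
      moved : ¬ (turn s h ≈ h)
      moved r = flip-≢ s (fl-injective r (fl-turn s h))
      onEdge : σE ⟨$⟩ʳ edge (turn s h) ≡ edge (turn⁻ s m)
      onEdge with proj₁ k-F ≟ s
      ... | yes q = trans (sym (edge-rep _)) (edge-cong (unique s s
              (trans k-V (sym (vl-turn⁻ s m)))
              (trans (cong (λ t → fl t k) (sym q)) (trans (proj₂ k-F) (sym (fl-turn⁻ s m))))))
      ... | no  q = contradiction
              (edge-injective (injective σE (trans (sym (edge-rep _)) (trans
                (edge-cong (unique s (flip s) k-V
                  (trans (cong (λ t → fl t k) (sym (≢⇒flip q))) (proj₂ k-F))))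
                (sym onE)))))
              moved

    reverses-mirror : ∀ {h m} → Reverses o o → Mirror X X⁻ Y Y⁻ o h m → Reverses h m
    reverses-mirror R base     = R
    reverses-mirror R (mirX w) = reverses-turn zero (reverses-mirror R w)
    reverses-mirror R (mirY w) = reverses-turn (suc zero) (reverses-mirror R w)

  not-transitive : ¬ (∀ Φ Ψ → Σ Automorphism λ a → Automorphism.Maps a Φ Ψ)
  not-transitive all = disagree (edge-injective
    (trans (sym (Reverses.onE (mirrored mirror₁)))
      (trans (cong (σE ⟨$⟩ʳ_) (edge-cong agree)) (Reverses.onE (mirrored mirror₂)))))
    where
    -- It would fix the base edge and a base vertex and exchange the two base faces.
    reflection = all (toFlag zero zero o) (toFlag zero (suc zero) o)
    ρ = proj₁ reflection
    open Automorphism ρ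
    mirrored : ∀ {h m} → Mirror X X⁻ Y Y⁻ o h m → Reverses ρ h m
    mirrored = let v , e , f = proj₂ reflection in reverses-mirror ρ (reverses ρ zero zero e v f)

  chiralPolyhedron : ChiralPolyhedron (2 ℕ.* n) q
  chiralPolyhedron = record
    { poset = poset ; isPolyhedron = isPolyhedron ; hasType = face-edges , vertex-edges
    ; isChiral = colour , alternating , transitive , not-transitive
    ; vertices = refl ; faces = refl }

-- Residues

∣-by : ∀ {n i j} → j ≡ i → n ∣ i → n ∣ j
∣-by refl h = h

remainder-unique : ∀ n r s → r ℕ.< n → s ℕ.< n → + n ∣ + r - + s → r ≡ s
remainder-unique n r s r<n s<n h = ℤ.+-injective (ℤ.i-j≡0⇒i≡j (+ r) (+ s) (ℤ.∣i∣≡0⇒i≡0 gap≡0))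
  where
  gap<n : abs (+ r - + s) ℕ.< n
  gap<n = ℕ.≤-<-trans (subst (λ i → abs i ℕ.≤ r ℕ.⊔ s) (sym (ℤ.m-n≡m⊖n r s)) (ℤ.∣m⊝n∣≤m⊔n r s))
    (ℕ.⊔-lub r<n s<n)
  gap≡0 : abs (+ r - + s) ≡ 0
  gap≡0 with abs (+ r - + s) | gap<n | ∣⇒∣ᵤ h
  ... | zero  | _  | _   = refl
  ... | suc g | lt | n∣g = contradiction n∣g (ℕ.>⇒∤ lt)

module _ (n : ℕ) .{{_ : NonZero n}} where

  %ℕ-cong : ∀ i → + n ∣ i - + (i %ℕ n)
  %ℕ-cong i = divides (i /ℕ n) (trans (cong (_- + (i %ℕ n)) (a≡a%ℕn+[a/ℕn]*n i n)) (cancel (+ (i %ℕ n)) _))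
    where
    cancel : ∀ r m → r + m - r ≡ m
    cancel = solve-∀

  res : ℤ → Fin n
  res i = fromℕ< (n%ℕd<d i n)

  res-injective : ∀ i j → res i ≡ res j → + n ∣ i - j
  res-injective i j h = ∣-by (telescope i j (+ (i %ℕ n)))
    (∣m∣n⇒∣m+n (%ℕ-cong i) (∣m⇒∣-m (subst (λ r → + n ∣ j - + r) (sym same) (%ℕ-cong j))))
    where
    same : i %ℕ n ≡ j %ℕ n
    same = trans (sym (toℕ-fromℕ< (n%ℕd<d i n))) (trans (cong toℕ h) (toℕ-fromℕ< (n%ℕd<d j n)))
    telescope : ∀ i j r → i - j ≡ (i - r) + - (j - r)
    telescope = solve-∀

  %ℕ-unique : ∀ i r → r ℕ.< n → + n ∣ i - + r → i %ℕ n ≡ r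
  %ℕ-unique i r r<n h = remainder-unique n _ r (n%ℕd<d i n) r<n
    (∣-by (telescope (+ (i %ℕ n)) i (+ r)) (∣m∣n⇒∣m+n (∣m⇒∣-m (%ℕ-cong i)) h))
    where
    telescope : ∀ s i r → s - r ≡ - (i - s) + (i - r)
    telescope = solve-∀

  res-cong : ∀ i j → + n ∣ i - j → res i ≡ res j
  res-cong i j h = toℕ-injective (trans (toℕ-fromℕ< (n%ℕd<d i n))
    (trans (%ℕ-unique i (j %ℕ n) (n%ℕd<d j n)
      (∣-by (telescope i j (+ (j %ℕ n))) (∣m∣n⇒∣m+n h (%ℕ-cong j))))
    (sym (toℕ-fromℕ< (n%ℕd<d j n)))))
    where
    telescope : ∀ i j r → i - r ≡ (i - j) + (j - r)
    telescope = solve-∀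

  res-toℕ : ∀ f i → + n ∣ i - + toℕ f → res i ≡ f
  res-toℕ f i h = toℕ-injective (trans (toℕ-fromℕ< (n%ℕd<d i n)) (%ℕ-unique i (toℕ f) (toℕ<n f) h))

-- The solution is reduced modulo mn to become a natural number, because it will serve as a number
-- of iterations of `U`.
chinese-remainder : ∀ m n .{{_ : NonZero m}} .{{_ : NonZero n}} → Coprime m n →
  ∀ x y → ∃ λ k → + m ∣ + k - x × + n ∣ + k - y
chinese-remainder m n cop x y =
  k₀ %ℕ mn , on m x k₀ (divides (+ n) (trans (ℤ.pos-* m n) (ℤ.*-comm (+ m) (+ n)))) (divides (s * (y - x)) k₀-x)
           , on n y k₀ (divides (+ m) (ℤ.pos-* m n)) (divides (t * (x - y)) k₀-y)
  where
  mn = m ℕ.* n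
  instance
    mn≢0 : NonZero mn
    mn≢0 = ℕ.m*n≢0 m n
  move : ∀ d a u b v → d + b * v ≡ a * u → a * u + - b * v ≡ d
  move d a u b v h = trans (cong (_+ - b * v) (sym h)) (cancel d b v)
    where
    cancel : ∀ d b v → d + b * v + - b * v ≡ d
    cancel = solve-∀
  lift : ∀ a u b v → 1 ℕ.+ b ℕ.* v ≡ a ℕ.* u → + a * + u + - (+ b) * + v ≡ + 1
  lift a u b v h = move (+ 1) (+ a) (+ u) (+ b) (+ v)
    (trans (cong (λ i → + 1 + i) (sym (ℤ.pos-* b v)))
      (trans (sym (ℤ.pos-+ 1 (b ℕ.* v))) (trans (cong +_ h) (ℤ.pos-* a u))))
  coefficients : ∃ λ s → ∃ λ t → s * + m + t * + n ≡ + 1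
  coefficients with coprime-Bézout cop
  ... | Bézout.+- a b h = + a , - (+ b) , lift a m b n h
  ... | Bézout.-+ a b h = - (+ a) , + b , trans (ℤ.+-comm _ (+ b * + n)) (lift b n a m h)
  s = proj₁ coefficients
  t = proj₁ (proj₂ coefficients)
  k₀ = x * (t * + n) + y * (s * + m)
  unit : ∀ z → z * (s * + m + t * + n) ≡ z
  unit z = trans (cong (z *_) (proj₂ (proj₂ coefficients))) (ℤ.*-identityʳ z)
  k₀-x : k₀ - x ≡ s * (y - x) * + m
  k₀-x = trans (cong (λ z → k₀ - z) (sym (unit x))) (ring x y s t (+ m) (+ n))
    where
    ring : ∀ x y s t m n → x * (t * n) + y * (s * m) - x * (s * m + t * n) ≡ s * (y - x) * m
    ring = solve-∀
  k₀-y : k₀ - y ≡ t * (x - y) * + n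
  k₀-y = trans (cong (λ z → k₀ - z) (sym (unit y))) (ring x y s t (+ m) (+ n))
    where
    ring : ∀ x y s t m n → x * (t * n) + y * (s * m) - y * (s * m + t * n) ≡ t * (x - y) * n
    ring = solve-∀
  on : ∀ d z k → + d ∣ + mn → + d ∣ k - z → + d ∣ + (k %ℕ mn) - z
  on d z k d∣mn h = ∣-by (telescope (+ (k %ℕ mn)) k z)
    (∣m∣n⇒∣m+n (∣m⇒∣-m (∣-trans d∣mn (%ℕ-cong mn k))) h)
    where
    telescope : ∀ r k z → r - z ≡ - (k - r) + (k - z)
    telescope = solve-∀

-- Parity and triangular numbers

odd : ℤ → ℤ
odd i = + (i %ℕ 2)

half : ℤ → ℤ
half i = i /ℕ 2

odd-half : ∀ i → i ≡ odd i + half i * + 2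
odd-half i = a≡a%ℕn+[a/ℕn]*n i 2

odd-unique : ∀ i r → r ℕ.< 2 → + 2 ∣ i - + r → odd i ≡ + r
odd-unique i r r<2 h = cong +_ (%ℕ-unique 2 i r r<2 h)

odd-cases : ∀ i → odd i ≡ + 0 ⊎ odd i ≡ + 1
odd-cases i with i %ℕ 2 | n%ℕd<d i 2
... | 0 | _ = inj₁ refl
... | 1 | _ = inj₂ refl
... | suc (suc _) | ℕ.s≤s (ℕ.s≤s ())

odd-idem : ∀ i → odd i * odd i ≡ odd i
odd-idem i with odd-cases i
... | inj₁ h = subst (λ r → r * r ≡ r) (sym h) refl
... | inj₂ h = subst (λ r → r * r ≡ r) (sym h) refl

-- Exclusive or, written as a crossed homomorphism: the sign 1 - 2 `odd i` is the one by which xⁱ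
-- acts on u₂. This is the form needed to show that `τ` is multiplicative.
odd-+ : ∀ i j → odd (i + j) ≡ odd i + (+ 1 - + 2 * odd i) * odd j
odd-+ i j = lem (odd-cases i) (odd-cases j)
  where
  Sum = odd (i + j) ≡ odd i + (+ 1 - + 2 * odd i) * odd j
  at-values : ∀ x y r → odd i ≡ x → odd j ≡ y → r ℕ.< 2 → + 2 ∣ x + y - + r →
    + r ≡ x + (+ 1 - + 2 * x) * y → Sum
  at-values _ _ r refl refl r<2 h e = trans (odd-unique (i + j) r r<2
    (∣-by (trans (cong₂ (λ i j → i + j - + r) (odd-half i) (odd-half j))
        (regroup (odd i) (odd j) (half i) (half j) (+ r)))
      (∣m∣n⇒∣m+n h (divides (half i + half j) refl)))) e
    where
    regroup : ∀ x y h k r → (x + h * + 2) + (y + k * + 2) - r ≡ (x + y - r) + (h + k) * + 2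
    regroup = solve-∀
  lem : odd i ≡ + 0 ⊎ odd i ≡ + 1 → odd j ≡ + 0 ⊎ odd j ≡ + 1 → Sum
  lem (inj₁ h) (inj₁ k) = at-values _ _ 0 h k (ℕ.s≤s ℕ.z≤n) (divides (+ 0) refl) refl
  lem (inj₁ h) (inj₂ k) = at-values _ _ 1 h k (ℕ.s≤s (ℕ.s≤s ℕ.z≤n)) (divides (+ 0) refl) refl
  lem (inj₂ h) (inj₁ k) = at-values _ _ 1 h k (ℕ.s≤s (ℕ.s≤s ℕ.z≤n)) (divides (+ 0) refl) refl
  lem (inj₂ h) (inj₂ k) = at-values _ _ 0 h k (ℕ.s≤s ℕ.z≤n) (divides (+ 1) refl) refl

odd-neg : ∀ i → odd (- i) ≡ odd i
odd-neg i = odd-unique (- i) (i %ℕ 2) (n%ℕd<d i 2)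
  (divides (- half i - odd i) (trans (cong (λ j → - j - odd i) (odd-half i)) (ring (odd i) (half i))))
  where
  ring : ∀ r h → - (r + h * + 2) - r ≡ (- h - r) * + 2
  ring = solve-∀

odd-cong : ∀ i j → + 2 ∣ i - j → odd i ≡ odd j
odd-cong i j h = odd-unique i (j %ℕ 2) (n%ℕd<d j 2)
  (∣-by (telescope i j (odd j)) (∣m∣n⇒∣m+n h (%ℕ-cong 2 j)))
  where
  telescope : ∀ i j r → i - r ≡ (i - j) + (j - r)
  telescope = solve-∀

-- This is i(i+1)/2 for all integers i, freed of the division by means of i = r + 2h and r² = r for
-- r = `odd i`.
tri : ℤ → ℤ
tri i = half i * (+ 2 * half i + odd i + + 1) + odd i * (half i + + 1)

2*tri : ∀ i → + 2 * tri i ≡ i * i + i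
2*tri i = begin
  + 2 * tri i                               ≡⟨ ring₁ (odd i) (half i) ⟩
  p (odd i) (half i) + odd i                ≡⟨ cong (λ r → p (odd i) (half i) + r) (sym (odd-idem i)) ⟩
  p (odd i) (half i) + odd i * odd i        ≡⟨ ring₂ (odd i) (half i) ⟩
  (odd i + half i * + 2) * (odd i + half i * + 2) + (odd i + half i * + 2)
                                            ≡⟨ cong (λ j → j * j + j) (sym (odd-half i)) ⟩
  i * i + i                                 ∎
  where
  open ≡-Reasoning
  p : ℤ → ℤ → ℤ
  p r h = + 4 * h * h + + 4 * h * r + + 2 * h + r
  ring₁ : ∀ r h → + 2 * (h * (+ 2 * h + r + + 1) + r * (h + + 1)) ≡ + 4 * h * h + + 4 * h * r + + 2 * h + r + r
  ring₁ = solve-∀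
  ring₂ : ∀ r h → + 4 * h * h + + 4 * h * r + + 2 * h + r + r * r ≡ (r + h * + 2) * (r + h * + 2) + (r + h * + 2)
  ring₂ = solve-∀

tri-+ : ∀ i j → tri (i + j) ≡ tri i + tri j + i * j
tri-+ i j = ℤ.*-cancelˡ-≡ (+ 2) _ _ (begin
  + 2 * tri (i + j)                         ≡⟨ 2*tri (i + j) ⟩
  (i + j) * (i + j) + (i + j)               ≡⟨ ring₁ i j ⟩
  (i * i + i) + (j * j + j) + + 2 * (i * j) ≡⟨ cong (_+ + 2 * (i * j)) (cong₂ _+_ (sym (2*tri i)) (sym (2*tri j))) ⟩
  + 2 * tri i + + 2 * tri j + + 2 * (i * j) ≡⟨ ring₂ (tri i) (tri j) (i * j) ⟩
  + 2 * (tri i + tri j + i * j)             ∎)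
  where
  open ≡-Reasoning
  ring₁ : ∀ i j → (i + j) * (i + j) + (i + j) ≡ (i * i + i) + (j * j + j) + + 2 * (i * j)
  ring₁ = solve-∀
  ring₂ : ∀ x y z → + 2 * x + + 2 * y + + 2 * z ≡ + 2 * (x + y + z)
  ring₂ = solve-∀

tri-neg : ∀ i → tri (- i) ≡ tri i - i
tri-neg i = ℤ.*-cancelˡ-≡ (+ 2) _ _ (begin
  + 2 * tri (- i)         ≡⟨ 2*tri (- i) ⟩
  - i * - i + - i         ≡⟨ ring₁ i ⟩
  i * i + i - + 2 * i     ≡⟨ cong (_- + 2 * i) (sym (2*tri i)) ⟩
  + 2 * tri i - + 2 * i   ≡⟨ ring₂ (tri i) i ⟩
  + 2 * (tri i - i)       ∎)
  where
  open ≡-Reasoning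
  ring₁ : ∀ i → - i * - i + - i ≡ i * i + i - + 2 * i
  ring₁ = solve-∀
  ring₂ : ∀ x i → + 2 * x - + 2 * i ≡ + 2 * (x - i)
  ring₂ = solve-∀

-- The infinite cover of N

-- ⟨ a , d , b , e ⟩ stands for u₁ᵃ u₂ᵈ xᵇ zᵉ, where z = x⁻¹u₁⁻¹xu₁ is central and x inverts u₂.
record H : Set where
  constructor ⟨_,_,_,_⟩
  field
    a d b e : ℤ

open H

⟨⟩-cong : ∀ {a a′ d d′ b b′ e e′} → a ≡ a′ → d ≡ d′ → b ≡ b′ → e ≡ e′ →
  ⟨ a , d , b , e ⟩ ≡ ⟨ a′ , d′ , b′ , e′ ⟩
⟨⟩-cong refl refl refl refl = refl

ε : ℤ → ℤ
ε i = + 1 - + 2 * odd i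

ε-+ : ∀ i j → ε (i + j) ≡ ε i * ε j
ε-+ i j = trans (cong (λ r → + 1 - + 2 * r) (odd-+ i j)) (ring (odd i) (odd j))
  where
  ring : ∀ x y → + 1 - + 2 * (x + (+ 1 - + 2 * x) * y) ≡ (+ 1 - + 2 * x) * (+ 1 - + 2 * y)
  ring = solve-∀

ε-neg : ∀ i → ε (- i) ≡ ε i
ε-neg i = cong (λ r → + 1 - + 2 * r) (odd-neg i)

ε² : ∀ i → ε i * ε i ≡ + 1
ε² i = trans (ring₁ (odd i)) (trans (cong (λ r → + 1 - + 4 * (odd i - r)) (odd-idem i)) (ring₂ (odd i)))
  where
  ring₁ : ∀ x → (+ 1 - + 2 * x) * (+ 1 - + 2 * x) ≡ + 1 - + 4 * (x - x * x)
  ring₁ = solve-∀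
  ring₂ : ∀ x → + 1 - + 4 * (x - x) ≡ + 1
  ring₂ = solve-∀

infixl 7 _∙_
-- Collecting uses xᵇu₁ᵃ = u₁ᵃxᵇzᵃᵇ, while moving xᵇ past a power of u₂ multiplies its exponent by
-- (-1)ᵇ = `ε b`.
_∙_ : H → H → H
g ∙ h = ⟨ a g + a h , d g + ε (b g) * d h , b g + b h , e g + e h + b g * a h ⟩

-- `y` is the normal form of x⁻¹u₁u₂, so that xy = u₁u₂ is u.
1H x y : H
1H = ⟨ + 0 , + 0 , + 0 , + 0 ⟩
x  = ⟨ + 0 , + 0 , + 1 , + 0 ⟩
y  = ⟨ + 1 , - + 1 , - + 1 , - + 1 ⟩

inv : H → H
inv h = ⟨ - a h , - (ε (b h) * d h) , - b h , - e h + b h * a h ⟩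

-- The automorphism exchanging x and y. It sends u₁ to u₁z⁻¹ and inverts u₂ and z; the rest of the
-- formula is the normal form of yᵇ, whose u₂-exponent is -`odd b` and whose z-exponent is -`tri b`.
τ : H → H
τ h = ⟨ a h + b h , - d h - odd (b h) , - b h , - a h - tri (b h) - e h ⟩

∙-assoc : ∀ f g h → f ∙ g ∙ h ≡ f ∙ (g ∙ h)
∙-assoc f g h = ⟨⟩-cong
  (ℤ.+-assoc (a f) (a g) (a h))
  (trans (cong (λ r → d f + ε (b f) * d g + r * d h) (ε-+ (b f) (b g)))
    (ring₁ (d f) (d g) (d h) (ε (b f)) (ε (b g))))
  (ℤ.+-assoc (b f) (b g) (b h))
  (ring₂ (e f) (e g) (e h) (b f) (b g) (a g) (a h))
  where
  ring₁ : ∀ d d′ d″ r r′ → d + r * d′ + r * r′ * d″ ≡ d + r * (d′ + r′ * d″)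
  ring₁ = solve-∀
  ring₂ : ∀ e e′ e″ b b′ a′ a″ → e + e′ + b * a′ + e″ + (b + b′) * a″ ≡ e + (e′ + e″ + b′ * a″) + b * (a′ + a″)
  ring₂ = solve-∀

∙-identityˡ : ∀ h → 1H ∙ h ≡ h
∙-identityˡ h = ⟨⟩-cong (ring₁ (a h)) (ring₂ (d h)) (ring₁ (b h)) (ring₃ (e h) (a h))
  where
  ring₁ : ∀ i → + 0 + i ≡ i
  ring₁ = solve-∀
  ring₂ : ∀ i → + 0 + + 1 * i ≡ i
  ring₂ = solve-∀
  ring₃ : ∀ i j → + 0 + i + + 0 * j ≡ i
  ring₃ = solve-∀

∙-identityʳ : ∀ h → h ∙ 1H ≡ h
∙-identityʳ h = ⟨⟩-cong (ring₁ (a h)) (ring₂ (d h) (ε (b h))) (ring₁ (b h)) (ring₃ (e h) (b h))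
  where
  ring₁ : ∀ i → i + + 0 ≡ i
  ring₁ = solve-∀
  ring₂ : ∀ i r → i + r * + 0 ≡ i
  ring₂ = solve-∀
  ring₃ : ∀ i j → i + + 0 + j * + 0 ≡ i
  ring₃ = solve-∀

inv-∙ : ∀ h → inv h ∙ h ≡ 1H
inv-∙ h = ⟨⟩-cong (ring₁ (a h))
  (trans (cong (λ r → - (ε (b h) * d h) + r * d h) (ε-neg (b h))) (ring₁ (ε (b h) * d h)))
  (ring₁ (b h)) (ring₂ (e h) (b h) (a h))
  where
  ring₁ : ∀ i → - i + i ≡ + 0
  ring₁ = solve-∀
  ring₂ : ∀ e b a → - e + b * a + e + - b * a ≡ + 0
  ring₂ = solve-∀

∙-inv : ∀ h → h ∙ inv h ≡ 1H
∙-inv h = ⟨⟩-cong (ring₁ (a h))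
  (trans (ring₂ (ε (b h)) (d h)) (trans (cong (λ r → d h - r * d h) (ε² (b h))) (ring₃ (d h))))
  (ring₁ (b h)) (ring₄ (e h) (b h) (a h))
  where
  ring₁ : ∀ i → i + - i ≡ + 0
  ring₁ = solve-∀
  ring₂ : ∀ r d → d + r * - (r * d) ≡ d - r * r * d
  ring₂ = solve-∀
  ring₃ : ∀ d → d - + 1 * d ≡ + 0
  ring₃ = solve-∀
  ring₄ : ∀ e b a → e + (- e + b * a) + b * - a ≡ + 0
  ring₄ = solve-∀

τ-∙ : ∀ g h → τ (g ∙ h) ≡ τ g ∙ τ h
τ-∙ g h = ⟨⟩-cong
  (ring₁ (a g) (a h) (b g) (b h))
  (trans (cong (λ r → - (d g + ε (b g) * d h) - r) (odd-+ (b g) (b h)))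
    (trans (ring₂ (d g) (d h) (ε (b g)) (odd (b g)) (odd (b h)))
      (cong (λ r → - d g - odd (b g) + r * (- d h - odd (b h))) (sym (ε-neg (b g))))))
  (ring₃ (b g) (b h))
  (trans (cong (λ r → - (a g + a h) - r - (e g + e h + b g * a h)) (tri-+ (b g) (b h)))
    (ring₄ (a g) (a h) (b g) (b h) (e g) (e h) (tri (b g)) (tri (b h))))
  where
  ring₁ : ∀ a a′ b b′ → a + a′ + (b + b′) ≡ a + b + (a′ + b′)
  ring₁ = solve-∀
  ring₂ : ∀ d d′ r x y → - (d + r * d′) - (x + r * y) ≡ - d - x + r * (- d′ - y)
  ring₂ = solve-∀
  ring₃ : ∀ b b′ → - (b + b′) ≡ - b + - b′
  ring₃ = solve-∀
  ring₄ : ∀ a a′ b b′ e e′ t t′ → - (a + a′) - (t + t′ + b * b′) - (e + e′ + b * a′)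
    ≡ - a - t - e + (- a′ - t′ - e′) + - b * (a′ + b′)
  ring₄ = solve-∀

τ-involutive : ∀ h → τ (τ h) ≡ h
τ-involutive h = ⟨⟩-cong
  (ring₁ (a h) (b h))
  (trans (cong (λ r → - (- d h - odd (b h)) - r) (odd-neg (b h))) (ring₂ (d h) (odd (b h))))
  (ℤ.neg-involutive (b h))
  (trans (cong (λ r → - (a h + b h) - r - (- a h - tri (b h) - e h)) (tri-neg (b h)))
    (ring₃ (a h) (b h) (e h) (tri (b h))))
  where
  ring₁ : ∀ a b → a + b + - b ≡ a
  ring₁ = solve-∀
  ring₂ : ∀ d r → - (- d - r) - r ≡ d
  ring₂ = solve-∀
  ring₃ : ∀ a b e t → - (a + b) - (t - b) - (- a - t - e) ≡ e
  ring₃ = solve-∀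

X X⁻ Y Y⁻ : H → H
X  h = ⟨ a h , d h , b h + + 1 , e h ⟩
X⁻ h = ⟨ a h , d h , b h - + 1 , e h ⟩
Y  h = τ (X (τ h))
Y⁻ h = τ (X⁻ (τ h))

X-X⁻ : ∀ h → X (X⁻ h) ≡ h
X-X⁻ h = ⟨⟩-cong refl refl (ring (b h)) refl
  where
  ring : ∀ i → i - + 1 + + 1 ≡ i
  ring = solve-∀

X⁻-X : ∀ h → X⁻ (X h) ≡ h
X⁻-X h = ⟨⟩-cong refl refl (ring (b h)) refl
  where
  ring : ∀ i → i + + 1 - + 1 ≡ i
  ring = solve-∀

X≡∙x : ∀ h → X h ≡ h ∙ x
X≡∙x h = ⟨⟩-cong (ring₁ (a h)) (ring₂ (d h) (ε (b h))) refl (ring₃ (e h) (b h))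
  where
  ring₁ : ∀ i → i ≡ i + + 0
  ring₁ = solve-∀
  ring₂ : ∀ i r → i ≡ i + r * + 0
  ring₂ = solve-∀
  ring₃ : ∀ i j → i ≡ i + + 0 + j * + 0
  ring₃ = solve-∀

Y≡∙y : ∀ h → Y h ≡ h ∙ y
Y≡∙y h = trans (cong τ (X≡∙x (τ h))) (trans (τ-∙ (τ h) x) (cong (_∙ y) (τ-involutive h)))

U : H → H
U h = Y (X h)

U-formula : ∀ h → U h ≡ ⟨ a h + + 1 , d h + ε (b h) , b h , e h + b h ⟩
U-formula h = trans (trans (Y≡∙y (X h)) (cong (_∙ y) (X≡∙x h))) (trans (∙-assoc h x y)
  (⟨⟩-cong refl (ring₁ (d h) (ε (b h))) (ring₂ (b h)) (ring₃ (e h) (b h))))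
  where
  ring₁ : ∀ d r → d + r * + 1 ≡ d + r
  ring₁ = solve-∀
  ring₂ : ∀ b → b + + 0 ≡ b
  ring₂ = solve-∀
  ring₃ : ∀ e b → e + + 0 + b * + 1 ≡ e + b
  ring₃ = solve-∀

iterate-X : ∀ k h → iterate X k h ≡ ⟨ a h , d h , b h + + k , e h ⟩
iterate-X zero    h = ⟨⟩-cong refl refl (sym (ℤ.+-identityʳ (b h))) refl
iterate-X (suc k) h = trans (iterate-X k (X h)) (⟨⟩-cong refl refl (ℤ.+-assoc (b h) (+ 1) (+ k)) refl)

iterate-U : ∀ k h → iterate U k h ≡ ⟨ a h + + k , d h + ε (b h) * + k , b h , e h + b h * + k ⟩
iterate-U zero    h = ⟨⟩-cong (sym (ℤ.+-identityʳ (a h))) (ring (d h) (ε (b h))) refl (ring (e h) (b h))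
  where
  ring : ∀ i r → i ≡ i + r * + 0
  ring = solve-∀
iterate-U (suc k) h = trans (cong (iterate U k) (U-formula h)) (trans (iterate-U k _)
  (⟨⟩-cong (ℤ.+-assoc (a h) (+ 1) (+ k)) (ring (d h) (ε (b h)) (+ k)) refl (ring (e h) (b h) (+ k))))
  where
  ring : ∀ i r k → i + r + r * k ≡ i + r * (+ 1 + k)
  ring = solve-∀

-- The automorphism x ↦ x⁻¹, y ↦ y⁻¹.
mirror : H → H
mirror h = ⟨ - a h , d h , - b h , a h + e h ⟩

mirror-X : ∀ h → X⁻ (mirror h) ≡ mirror (X h)
mirror-X h = ⟨⟩-cong refl refl (ring (b h)) refl
  where
  ring : ∀ i → - i - + 1 ≡ - (i + + 1)
  ring = solve-∀

y⁻ : H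
y⁻ = ⟨ - + 1 , - + 1 , + 1 , + 0 ⟩

X⁻≡∙x⁻ : ∀ h → X⁻ h ≡ h ∙ ⟨ + 0 , + 0 , - + 1 , + 0 ⟩
X⁻≡∙x⁻ h = ⟨⟩-cong (ring₁ (a h)) (ring₂ (d h) (ε (b h))) refl (ring₃ (e h) (b h))
  where
  ring₁ : ∀ i → i ≡ i + + 0
  ring₁ = solve-∀
  ring₂ : ∀ i r → i ≡ i + r * + 0
  ring₂ = solve-∀
  ring₃ : ∀ i j → i ≡ i + + 0 + j * + 0
  ring₃ = solve-∀

Y⁻≡∙y⁻ : ∀ h → Y⁻ h ≡ h ∙ y⁻
Y⁻≡∙y⁻ h = trans (cong τ (X⁻≡∙x⁻ (τ h))) (trans (τ-∙ (τ h) _) (cong (_∙ y⁻) (τ-involutive h)))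

mirror-∙ : ∀ g h → mirror (g ∙ h) ≡ mirror g ∙ mirror h
mirror-∙ g h = ⟨⟩-cong (ring₁ (a g) (a h))
  (cong (λ r → d g + r * d h) (sym (ε-neg (b g)))) (ring₁ (b g) (b h))
  (ring₂ (a g) (a h) (b g) (e g) (e h))
  where
  ring₁ : ∀ i j → - (i + j) ≡ - i + - j
  ring₁ = solve-∀
  ring₂ : ∀ a a′ b e e′ → a + a′ + (e + e′ + b * a′) ≡ a + e + (a′ + e′) + - b * - a′
  ring₂ = solve-∀

mirror-Y : ∀ h → Y⁻ (mirror h) ≡ mirror (Y h)
mirror-Y h = sym (trans (cong mirror (Y≡∙y h)) (trans (mirror-∙ h y) (sym (Y⁻≡∙y⁻ (mirror h)))))

-- In the cover no relation ties z to u₁ and x, so inverting x and y extends to an automorphism, and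
-- `mirror` gives the value of every mirrored word.
Mirrored : H → Set
Mirrored h = Mirror X X⁻ Y Y⁻ 1H h (mirror h)

mirrored-X : ∀ {h} → Mirrored h → Mirrored (X h)
mirrored-X {h} w = subst (Mirror X X⁻ Y Y⁻ 1H (X h)) (mirror-X h) (mirX w)

mirrored-U : ∀ {h} → Mirrored h → Mirrored (U h)
mirrored-U {h} w = subst (Mirror X X⁻ Y Y⁻ 1H (U h)) (mirror-Y (X h)) (mirY (mirrored-X w))

mirrored-iterate : ∀ {f} → (∀ {h} → Mirrored h → Mirrored (f h)) →
  ∀ k {h} → Mirrored h → Mirrored (iterate f k h)
mirrored-iterate next zero    w = w
mirrored-iterate next (suc k) w = mirrored-iterate next k (next w)

-- The finite quotient

-- P, w and q are the orders of u₁, u₂ and x. `P∣q` is needed for exchanging x and y, since `τ` adds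
-- the exponent of x to that of u₁. `q∣4σP` belongs to zᴾ = 1, forced by u₁ᴾ = 1. `P∣4σ²` and
-- `q∣8σ²` say that z²ˢ = 1, which makes u₁²ˢx⁻⁴ˢ central like z. `parity` lets the action of xⁱ on
-- u₂ depend only on i modulo q. `q∤8σw` keeps the x-part of z²ʷ nontrivial.
module Quotient (P w q σ : ℕ) .{{P≢0 : NonZero P}} .{{w≢0 : NonZero w}} .{{q≢0 : NonZero q}}
  (P∣q     : + P ∣ + q)
  (q∣4σP   : + q ∣ + 4 * + σ * + P)
  (P∣4σ²   : + P ∣ + 4 * + σ * + σ)
  (q∣8σ²   : + q ∣ + 8 * + σ * + σ)
  (q∤8σw   : ¬ (+ q ∣ + 8 * + σ * + w))
  (coprime : Coprime P w)
  (parity  : ∀ i j → + q ∣ i - j → + w ∣ odd i - odd j) where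

  private
    s : ℤ
    s = + σ

  -- z is identified with u₁²ˢ x⁻⁴ˢ: A and B are the exponents of u₁ and x in the normal form u₁ᴬ u₂ᵈ xᴮ,
  -- while C is the exponent of x in the normal form xᶜ u₁ᴬ u₂ᵈ.
  A B C : H → ℤ
  A h = a h + + 2 * s * e h
  B h = b h - + 4 * s * e h
  C h = b h - + 4 * s * e h + + 4 * s * (a h * b h)

  infix 4 _≅_
  -- Normal forms are compared directly instead of forming a normal subgroup: it suffices that `X`,
  -- `X⁻`, `τ` and left translations respect this relation.
  record _≅_ (g h : H) : Set where
    constructor cong≅
    field
      A≅ : + P ∣ A g - A h
      D≅ : + w ∣ d g - d h
      B≅ : + q ∣ B g - B h
  open _≅_

  q∣4s* : ∀ k {i} → + P ∣ i → + q ∣ k * (+ 4 * s * i)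
  q∣4s* k {i} (divides m refl) = ∣-by (ring k s m (+ P)) (∣n⇒∣m*n (k * m) q∣4σP)
    where
    ring : ∀ k s m p → k * (+ 4 * s * (m * p)) ≡ k * m * (+ 4 * s * p)
    ring = solve-∀

  P∣ : ∀ {i} → + q ∣ i → + P ∣ i
  P∣ = ∣-trans P∣q

  -- Expressed through `A` and `B`, the operations leave remainders that vanish in the quotient. For
  -- `τ` and the product the remainder k is a factor z²ˢᵏ: it adds 4s²k to the exponent of u₁ and
  -- -8s²k to that of x.
  C-error τ-error : H → ℤ
  C-error h = + 2 * a h * e h - b h * e h + + 4 * s * e h * e h
  τ-error h = + 4 * s * e h * e h - + 2 * b h * e h

  ∙-error : H → H → ℤ
  ∙-error g h = + 2 * e g * a h + + 4 * s * e g * e h - b g * e h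

  C-of-AB : ∀ h → C h ≡ B h + + 4 * s * (A h * B h) + C-error h * (+ 8 * s * s)
  C-of-AB h = ring s (a h) (b h) (e h)
    where
    ring : ∀ s a b e → b - + 4 * s * e + + 4 * s * (a * b) ≡
      (b - + 4 * s * e) + + 4 * s * ((a + + 2 * s * e) * (b - + 4 * s * e)) + (+ 2 * a * e - b * e + + 4 * s * e * e) * (+ 8 * s * s)
    ring = solve-∀

  C≅ : ∀ {g h} → g ≅ h → + q ∣ C g - C h
  C≅ {g} {h} r = ∣-by
    (trans (cong₂ _-_ (C-of-AB g) (C-of-AB h)) (ring s (A g) (B g) (A h) (B h) (C-error g) (C-error h)))
    (∣m∣n⇒∣m+n (∣m∣n⇒∣m+n (∣n⇒∣m*n (+ 1 + + 4 * s * A h) (B≅ r)) (q∣4s* (B g) (A≅ r)))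
      (∣n⇒∣m*n (C-error g - C-error h) q∣8σ²))
    where
    ring : ∀ s A B A′ B′ k k′ →
      (B + + 4 * s * (A * B) + k * (+ 8 * s * s)) - (B′ + + 4 * s * (A′ * B′) + k′ * (+ 8 * s * s)) ≡
      (+ 1 + + 4 * s * A′) * (B - B′) + B * (+ 4 * s * (A - A′)) + (k - k′) * (+ 8 * s * s)
    ring = solve-∀

  -- (1 − 4sA) inverts 1 + 4sA modulo 8s².
  B-of-AC : ∀ {g h} → + P ∣ A g - A h → + q ∣ C g - C h → + q ∣ B g - B h
  B-of-AC {g} {h} rA rC = ∣-by
    (trans (ring s (A g) (B g) (A h) (B h) (C-error g) (C-error h))
      (cong (λ c → (+ 1 - + 4 * s * A h) * c + B g * (- (+ 1 - + 4 * s * A h) * (+ 4 * s * (A g - A h)))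
         + K * (+ 8 * s * s)) (sym (cong₂ _-_ (C-of-AB g) (C-of-AB h)))))
    (∣m∣n⇒∣m+n (∣m∣n⇒∣m+n (∣n⇒∣m*n (+ 1 - + 4 * s * A h) rC)
        (∣n⇒∣m*n (B g) (q∣4s* (- (+ 1 - + 4 * s * A h)) rA)))
      (∣n⇒∣m*n K q∣8σ²))
    where
    K  = + 2 * A h * A h * (B g - B h) - (+ 1 - + 4 * s * A h) * (C-error g - C-error h)
    ring : ∀ s A B A′ B′ k k′ → B - B′ ≡
      (+ 1 - + 4 * s * A′) * ((B + + 4 * s * (A * B) + k * (+ 8 * s * s)) - (B′ + + 4 * s * (A′ * B′) + k′ * (+ 8 * s * s)))
      + B * (- (+ 1 - + 4 * s * A′) * (+ 4 * s * (A - A′)))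
      + (+ 2 * A′ * A′ * (B - B′) - (+ 1 - + 4 * s * A′) * (k - k′)) * (+ 8 * s * s)
    ring = solve-∀

  odd≅ : ∀ {g h} → g ≅ h → + w ∣ odd (b g) - odd (b h)
  odd≅ {g} {h} r = subst₂ (λ i j → + w ∣ i - j) (odd-B g) (odd-B h) (parity (B g) (B h) (B≅ r))
    where
    odd-B : ∀ h → odd (B h) ≡ odd (b h)
    odd-B h = odd-cong (B h) (b h) (divides (- (+ 2 * s * e h)) (ring s (b h) (e h)))
      where
      ring : ∀ s b e → b - + 4 * s * e - b ≡ - (+ 2 * s * e) * + 2
      ring = solve-∀

  X-≅ : ∀ {g h} → g ≅ h → X g ≅ X h
  X-≅ {g} {h} r = cong≅ (A≅ r) (D≅ r) (∣-by (ring s (b g) (e g) (b h) (e h)) (B≅ r))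
    where
    ring : ∀ s b e b′ e′ → (b + + 1 - + 4 * s * e) - (b′ + + 1 - + 4 * s * e′) ≡ (b - + 4 * s * e) - (b′ - + 4 * s * e′)
    ring = solve-∀

  X⁻-≅ : ∀ {g h} → g ≅ h → X⁻ g ≅ X⁻ h
  X⁻-≅ {g} {h} r = cong≅ (A≅ r) (D≅ r) (∣-by (ring s (b g) (e g) (b h) (e h)) (B≅ r))
    where
    ring : ∀ s b e b′ e′ → (b - + 1 - + 4 * s * e) - (b′ - + 1 - + 4 * s * e′) ≡ (b - + 4 * s * e) - (b′ - + 4 * s * e′)
    ring = solve-∀

  -- The evenness of the exponent 2s is used here: 2s·`tri b` = s(b² + b) is a polynomial in b with
  -- integer coefficients, so it is determined by b modulo P.
  A-τ : ∀ h → A (τ h) ≡ A h + B h - + 2 * s * A h - s * (B h * B h + B h)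
    + τ-error h * (+ 4 * s * s)
  A-τ h = trans (ring₁ s (a h) (b h) (e h) (tri (b h)))
    (trans (cong (λ t → a h + b h - + 2 * s * (a h + e h) - s * t) (2*tri (b h))) (ring₂ s (a h) (b h) (e h)))
    where
    ring₁ : ∀ s a b e t → a + b + + 2 * s * (- a - t - e) ≡ a + b - + 2 * s * (a + e) - s * (+ 2 * t)
    ring₁ = solve-∀
    ring₂ : ∀ s a b e → a + b - + 2 * s * (a + e) - s * (b * b + b) ≡
      (a + + 2 * s * e) + (b - + 4 * s * e) - + 2 * s * (a + + 2 * s * e)
      - s * ((b - + 4 * s * e) * (b - + 4 * s * e) + (b - + 4 * s * e))
      + (+ 4 * s * e * e - + 2 * b * e) * (+ 4 * s * s)
    ring₂ = solve-∀

  B-τ : ∀ h → B (τ h) ≡ - B h + + 4 * s * A h + + 2 * s * (B h * B h + B h)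
    + - τ-error h * (+ 8 * s * s)
  B-τ h = trans (ring₁ s (a h) (b h) (e h) (tri (b h)))
    (trans (cong (λ t → - b h + + 4 * s * (a h + e h) + + 2 * s * t) (2*tri (b h))) (ring₂ s (a h) (b h) (e h)))
    where
    ring₁ : ∀ s a b e t → - b - + 4 * s * (- a - t - e) ≡ - b + + 4 * s * (a + e) + + 2 * s * (+ 2 * t)
    ring₁ = solve-∀
    ring₂ : ∀ s a b e → - b + + 4 * s * (a + e) + + 2 * s * (b * b + b) ≡
      - (b - + 4 * s * e) + + 4 * s * (a + + 2 * s * e)
      + + 2 * s * ((b - + 4 * s * e) * (b - + 4 * s * e) + (b - + 4 * s * e))
      + - (+ 4 * s * e * e - + 2 * b * e) * (+ 8 * s * s)
    ring₂ = solve-∀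

  τ-≅ : ∀ {g h} → g ≅ h → τ g ≅ τ h
  τ-≅ {g} {h} r = cong≅
    (∣-by (trans (cong₂ _-_ (A-τ g) (A-τ h)) (ring₁ s (A g) (B g) (A h) (B h) (τ-error g) (τ-error h)))
      (∣m∣n⇒∣m+n (∣m∣n⇒∣m+n (∣n⇒∣m*n (+ 1 - + 2 * s) (A≅ r))
        (∣n⇒∣m*n (+ 1 - s * (B g + B h + + 1)) (P∣ (B≅ r)))) (∣n⇒∣m*n (τ-error g - τ-error h) P∣4σ²)))
    (∣-by (ring₂ (d g) (d h) (odd (b g)) (odd (b h)))
      (∣m⇒∣-m (∣m∣n⇒∣m+n (D≅ r) (odd≅ r))))
    (∣-by (trans (cong₂ _-_ (B-τ g) (B-τ h)) (ring₃ s (A g) (B g) (A h) (B h) (- τ-error g) (- τ-error h)))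
      (∣m∣n⇒∣m+n (∣m∣n⇒∣m+n (q∣4s* (+ 1) (A≅ r))
        (∣n⇒∣m*n (+ 2 * s * (B g + B h + + 1) - + 1) (B≅ r))) (∣n⇒∣m*n (- τ-error g - - τ-error h) q∣8σ²)))
    where
    ring₁ : ∀ s A B A′ B′ k k′ →
      (A + B - + 2 * s * A - s * (B * B + B) + k * (+ 4 * s * s))
      - (A′ + B′ - + 2 * s * A′ - s * (B′ * B′ + B′) + k′ * (+ 4 * s * s)) ≡
      (+ 1 - + 2 * s) * (A - A′) + (+ 1 - s * (B + B′ + + 1)) * (B - B′) + (k - k′) * (+ 4 * s * s)
    ring₁ = solve-∀
    ring₂ : ∀ d d′ r r′ → (- d - r) - (- d′ - r′) ≡ - ((d - d′) + (r - r′))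
    ring₂ = solve-∀
    ring₃ : ∀ s A B A′ B′ k k′ →
      (- B + + 4 * s * A + + 2 * s * (B * B + B) + k * (+ 8 * s * s))
      - (- B′ + + 4 * s * A′ + + 2 * s * (B′ * B′ + B′) + k′ * (+ 8 * s * s)) ≡
      + 1 * (+ 4 * s * (A - A′)) + (+ 2 * s * (B + B′ + + 1) - + 1) * (B - B′) + (k - k′) * (+ 8 * s * s)
    ring₃ = solve-∀

  A-∙ : ∀ g h → A (g ∙ h) ≡ A g + A h + + 2 * s * (B g * A h)
    + ∙-error g h * (+ 4 * s * s)
  A-∙ g h = ring s (a g) (b g) (e g) (a h) (e h)
    where
    ring : ∀ s a b e a′ e′ → a + a′ + + 2 * s * (e + e′ + b * a′) ≡
      (a + + 2 * s * e) + (a′ + + 2 * s * e′) + + 2 * s * ((b - + 4 * s * e) * (a′ + + 2 * s * e′))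
      + (+ 2 * e * a′ + + 4 * s * e * e′ - b * e′) * (+ 4 * s * s)
    ring = solve-∀

  B-∙ : ∀ g h → B (g ∙ h) ≡ B g + B h - + 4 * s * (B g * A h)
    + - ∙-error g h * (+ 8 * s * s)
  B-∙ g h = ring s (b g) (e g) (a h) (b h) (e h)
    where
    ring : ∀ s b e a′ b′ e′ → b + b′ - + 4 * s * (e + e′ + b * a′) ≡
      (b - + 4 * s * e) + (b′ - + 4 * s * e′) - + 4 * s * ((b - + 4 * s * e) * (a′ + + 2 * s * e′))
      + - (+ 2 * e * a′ + + 4 * s * e * e′ - b * e′) * (+ 8 * s * s)
    ring = solve-∀

  ∙-≅ : ∀ m {g h} → g ≅ h → m ∙ g ≅ m ∙ h
  ∙-≅ m {g} {h} r = cong≅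
    (∣-by (trans (cong₂ _-_ (A-∙ m g) (A-∙ m h)) (ring₁ s (A m) (B m) (A g) (A h) (∙-error m g) (∙-error m h)))
      (∣m∣n⇒∣m+n (∣n⇒∣m*n (+ 1 + + 2 * s * B m) (A≅ r)) (∣n⇒∣m*n (∙-error m g - ∙-error m h) P∣4σ²)))
    (∣-by (ring₂ (d m) (ε (b m)) (d g) (d h)) (∣n⇒∣m*n (ε (b m)) (D≅ r)))
    (∣-by (trans (cong₂ _-_ (B-∙ m g) (B-∙ m h)) (ring₃ s (B m) (A g) (A h) (B g) (B h) (- ∙-error m g) (- ∙-error m h)))
      (∣m∣n⇒∣m+n (∣m∣n⇒∣m+n (B≅ r) (q∣4s* (- B m) (A≅ r))) (∣n⇒∣m*n (- ∙-error m g - - ∙-error m h) q∣8σ²)))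
    where
    ring₁ : ∀ s A B A′ A″ k k′ →
      (A + A′ + + 2 * s * (B * A′) + k * (+ 4 * s * s)) - (A + A″ + + 2 * s * (B * A″) + k′ * (+ 4 * s * s)) ≡
      (+ 1 + + 2 * s * B) * (A′ - A″) + (k - k′) * (+ 4 * s * s)
    ring₁ = solve-∀
    ring₂ : ∀ d r d′ d″ → (d + r * d′) - (d + r * d″) ≡ r * (d′ - d″)
    ring₂ = solve-∀
    ring₃ : ∀ s B A′ A″ B′ B″ k k′ →
      (B + B′ - + 4 * s * (B * A′) + k * (+ 8 * s * s)) - (B + B″ - + 4 * s * (B * A″) + k′ * (+ 8 * s * s)) ≡
      (B′ - B″) + - B * (+ 4 * s * (A′ - A″)) + (k - k′) * (+ 8 * s * s)
    ring₃ = solve-∀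

  α : H → Fin (P ℕ.* w)
  α h = combine (res P (A h)) (res w (d h))

  γ : H → Fin q
  γ h = res q (C h)

  α-injective : ∀ {g h} → α g ≡ α h → + P ∣ A g - A h × + w ∣ d g - d h
  α-injective {g} {h} r =
      res-injective P (A g) (A h) (combine-injectiveˡ (res P (A g)) (res w (d g)) (res P (A h)) (res w (d h)) r)
    , res-injective w (d g) (d h) (combine-injectiveʳ (res P (A g)) (res w (d g)) (res P (A h)) (res w (d h)) r)

  labels⇒≅ : ∀ {g h} → α g ≡ α h × γ g ≡ γ h → g ≅ h
  labels⇒≅ {g} {h} (r , f) = let rA , rD = α-injective {g} {h} r in
    cong≅ rA rD (B-of-AC {g} {h} rA (res-injective q (C g) (C h) f))

  ≅⇒labels : ∀ {g h} → g ≅ h → α g ≡ α h × γ g ≡ γ h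
  ≅⇒labels {g} {h} r = cong₂ combine (res-cong P (A g) (A h) (A≅ r)) (res-cong w (d g) (d h) (D≅ r))
                     , res-cong q (C g) (C h) (C≅ r)

  lift≅ : ∀ {f : H → H} → (∀ {g h} → g ≅ h → f g ≅ f h) →
    ∀ {g h} → α g ≡ α h × γ g ≡ γ h → α (f g) ≡ α (f h) × γ (f g) ≡ γ (f h)
  lift≅ {f} f-≅ {g} {h} r = ≅⇒labels {f g} {f h} (f-≅ (labels⇒≅ {g} {h} r))

  γ-U : ∀ h → γ (U h) ≡ γ h
  γ-U h = cong (res q) (trans (cong C (U-formula h)) (ring s (a h) (b h) (e h)))
    where
    ring : ∀ s a b e → b - + 4 * s * (e + b) + + 4 * s * ((a + + 1) * b) ≡ b - + 4 * s * e + + 4 * s * (a * b)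
    ring = solve-∀

  q∤1 : ¬ (+ q ∣ + 1)
  q∤1 h = q∤8σw (∣-by (sym (ℤ.*-identityʳ _)) (∣n⇒∣m*n (+ 8 * s * + w) h))

  γ-X≢ : ∀ h → γ (X h) ≢ γ h
  -- `X` raises `C` by 1 + 4sa, which is a unit modulo 8s² with inverse 1 - 4sa, as their product is
  -- 1 - 16s²a². Equal labels would give q ∣ 1.
  γ-X≢ h r = q∤1 (∣-by (ring s (a h) (b h) (e h))
    (∣m∣n⇒∣m+n (∣n⇒∣m*n (+ 1 - + 4 * s * a h) (res-injective q (C (X h)) (C h) r)) (∣n⇒∣m*n (+ 2 * a h * a h) q∣8σ²)))
    where
    ring : ∀ s a b e → + 1 ≡ (+ 1 - + 4 * s * a) *
      ((b + + 1 - + 4 * s * e + + 4 * s * (a * (b + + 1))) - (b - + 4 * s * e + + 4 * s * (a * b)))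
      + + 2 * a * a * (+ 8 * s * s)
    ring = solve-∀

  -- With e = 0 and a = i, `C` multiplies the exponent of x by 1 + 4si; the factor 1 - 4si
  -- compensates for this modulo 8s².
  at : Fin (P ℕ.* w) → Fin q → H
  at v f = ⟨ i , + toℕ (proj₂ (remQuot {P} w v)) , (+ 1 - + 4 * s * i) * + toℕ f , + 0 ⟩
    where i = + toℕ (proj₁ (remQuot {P} w v))

  α-at : ∀ v f → α (at v f) ≡ v
  α-at v f = trans
    (cong₂ combine
      (res-toℕ P _ (A (at v f)) (∣-by (ring₁ s (+ toℕ (proj₁ (remQuot {P} w v)))) (divides (+ 0) refl)))
      (res-toℕ w _ (d (at v f)) (∣-by (ring₂ (+ toℕ (proj₂ (remQuot {P} w v)))) (divides (+ 0) refl))))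
    (combine-remQuot {P} w v)
    where
    ring₁ : ∀ s i → i + + 2 * s * + 0 - i ≡ + 0
    ring₁ = solve-∀
    ring₂ : ∀ i → i - i ≡ + 0
    ring₂ = solve-∀

  γ-at : ∀ v f → γ (at v f) ≡ f
  γ-at v f = res-toℕ q f (C (at v f)) (∣-by (ring s i (+ toℕ f)) (∣n⇒∣m*n (- (+ 2 * i * i * + toℕ f)) q∣8σ²))
    where
    i = + toℕ (proj₁ (remQuot {P} w v))
    ring : ∀ s i f → ((+ 1 - + 4 * s * i) * f) - + 4 * s * + 0 + + 4 * s * (i * ((+ 1 - + 4 * s * i) * f)) - f
      ≡ - (+ 2 * i * i * f) * (+ 8 * s * s)
    ring = solve-∀

  X-orbit : ∀ g h → α g ≡ α h → ∃ λ k → α (iterate X k g) ≡ α h × γ (iterate X k g) ≡ γ h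
  X-orbit g h r = k , subst (λ g → α g ≡ α h × γ g ≡ γ h) (sym (iterate-X k g))
    (≅⇒labels {⟨ a g , d g , b g + + k , e g ⟩} {h} (cong≅ (proj₁ rr) (proj₂ rr)
      (∣-by (ring (+ k) s (b g) (e g) (B h)) (∣m⇒∣-m (%ℕ-cong q (B h - B g))))))
    where
    rr = α-injective {g} {h} r
    k = (B h - B g) %ℕ q
    ring : ∀ k s b e B → (b + k - + 4 * s * e) - B ≡ - (B - (b - + 4 * s * e) - k)
    ring = solve-∀

  U-orbit : ∀ g h → γ g ≡ γ h → ∃ λ k → α (iterate U k g) ≡ α h × γ (iterate U k g) ≡ γ h
  U-orbit g h r = k
    , trans (cong α (iterate-U k g)) (cong₂ combine
        (res-cong P (A g′) (A h) (∣-by (ring₁ s (a g) (b g) (e g) (+ k) (A h))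
          (∣m∣n⇒∣m+n (∣n⇒∣m*n (+ 1 + + 2 * s * b g) (proj₁ (proj₂ crt)))
            (∣n⇒∣m*n (- ((A h - A g) * b g * b g)) P∣4σ²))))
        (res-cong w (d g′) (d h) (∣-by (trans (cong (λ z → d g + ε (b g) * + k - z) (unit (d g) (d h)))
            (ring₂ (d g) (d h) (ε (b g)) (+ k)))
          (∣n⇒∣m*n (ε (b g)) (proj₂ (proj₂ crt))))))
    , trans (along k g) r
    where
    -- uᵏ adds (1 + 2sb)k to `A` and `ε b`·k to the exponent of u₂. Modulo 4s² the first factor has
    -- inverse 1 - 2sb, and the second is its own inverse.
    crt = chinese-remainder P w coprime ((+ 1 - + 2 * s * b g) * (A h - A g)) (ε (b g) * (d h - d g))
    k = proj₁ crt
    g′ = ⟨ a g + + k , d g + ε (b g) * + k , b g , e g + b g * + k ⟩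
    along : ∀ k g → γ (iterate U k g) ≡ γ g
    along zero    g = refl
    along (suc k) g = trans (along k (U g)) (γ-U g)
    unit : ∀ d d′ → d′ ≡ d + ε (b g) * (ε (b g) * (d′ - d))
    unit d d′ = trans (ring d d′) (trans (cong (λ r → d + r * (d′ - d)) (sym (ε² (b g)))) (ring′ d d′ (ε (b g))))
      where
      ring : ∀ d d′ → d′ ≡ d + + 1 * (d′ - d)
      ring = solve-∀
      ring′ : ∀ d d′ r → d + r * r * (d′ - d) ≡ d + r * (r * (d′ - d))
      ring′ = solve-∀
    ring₁ : ∀ s a b e k A′ → (a + k + + 2 * s * (e + b * k)) - A′ ≡
      (+ 1 + + 2 * s * b) * (k - (+ 1 - + 2 * s * b) * (A′ - (a + + 2 * s * e)))
      + - ((A′ - (a + + 2 * s * e)) * b * b) * (+ 4 * s * s)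
    ring₁ = solve-∀
    ring₂ : ∀ d d′ r k → d + r * k - (d + r * (r * (d′ - d))) ≡ r * (k - r * (d′ - d))
    ring₂ = solve-∀

  L : H → H → H → H
  L m m′ h = m′ ∙ inv m ∙ h

  L-maps : ∀ m m′ → L m m′ m ≡ m′
  L-maps m m′ = trans (∙-assoc m′ (inv m) m) (trans (cong (m′ ∙_) (inv-∙ m)) (∙-identityʳ m′))

  L-L : ∀ m m′ h → L m m′ (L m′ m h) ≡ h
  L-L m m′ h = begin
    m′ ∙ inv m ∙ (m ∙ inv m′ ∙ h) ≡⟨ sym (∙-assoc (m′ ∙ inv m) (m ∙ inv m′) h) ⟩
    m′ ∙ inv m ∙ (m ∙ inv m′) ∙ h ≡⟨ cong (_∙ h) (sym (∙-assoc (m′ ∙ inv m) m (inv m′))) ⟩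
    L m m′ m ∙ inv m′ ∙ h         ≡⟨ cong (λ k → k ∙ inv m′ ∙ h) (L-maps m m′) ⟩
    m′ ∙ inv m′ ∙ h               ≡⟨ cong (_∙ h) (∙-inv m′) ⟩
    1H ∙ h                        ≡⟨ ∙-identityˡ h ⟩
    h                             ∎
    where open ≡-Reasoning

  -- h₁ = x uʷ x⁴ˢʷ and h₂ = uʷ x u²ˢʷ agree since zʷ = u₁²ˢʷ x⁻⁴ˢʷ; their mirror images would give z²ʷ = 1.
  h₁ h₂ : H
  h₁ = iterate X (4 ℕ.* σ ℕ.* w) (iterate U w (X 1H))
  h₂ = iterate U (2 ℕ.* σ ℕ.* w) (X (iterate U w 1H))

  private
    W = + w
    pos₃ : ∀ i j k → + (i ℕ.* j ℕ.* k) ≡ + i * + j * + k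
    pos₃ i j k = trans (ℤ.pos-* (i ℕ.* j) k) (cong (_* + k) (ℤ.pos-* i j))

  h₁-formula : h₁ ≡ ⟨ W , - W , + 1 + + 4 * s * W , W ⟩
  h₁-formula = trans (iterate-X (4 ℕ.* σ ℕ.* w) (iterate U w (X 1H)))
    (trans (cong (λ g → ⟨ a g , d g , b g + + (4 ℕ.* σ ℕ.* w) , e g ⟩) (iterate-U w (X 1H)))
      (⟨⟩-cong (ring₁ W) (ring₂ W) (cong (λ i → + 1 + i) (pos₃ 4 σ w)) (ring₃ W)))
    where
    ring₁ : ∀ i → + 0 + i ≡ i
    ring₁ = solve-∀
    ring₂ : ∀ i → + 0 + - + 1 * i ≡ - i
    ring₂ = solve-∀
    ring₃ : ∀ i → + 0 + + 1 * i ≡ i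
    ring₃ = solve-∀

  h₂-formula : h₂ ≡ ⟨ W + + 2 * s * W , W - + 2 * s * W , + 1 , + 2 * s * W ⟩
  h₂-formula = trans (cong (λ g → iterate U (2 ℕ.* σ ℕ.* w) (X g)) (iterate-U w 1H))
    (trans (iterate-U (2 ℕ.* σ ℕ.* w) _)
      (trans (cong (λ i → ⟨ + 0 + W + i , + 0 + + 1 * W + - + 1 * i , + 1 , + 0 + + 0 * W + + 1 * i ⟩) (pos₃ 2 σ w))
        (⟨⟩-cong (ring₁ W (+ 2 * s * W)) (ring₂ W (+ 2 * s * W)) refl (ring₃ W (+ 2 * s * W)))))
    where
    ring₁ : ∀ i j → + 0 + i + j ≡ i + j
    ring₁ = solve-∀
    ring₂ : ∀ i j → + 0 + + 1 * i + - + 1 * j ≡ i - j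
    ring₂ = solve-∀
    ring₃ : ∀ i j → + 0 + + 0 * i + + 1 * j ≡ j
    ring₃ = solve-∀

  -- The exponents of u₂ in both elements are multiples of w. This is why powers of uʷ are used: in
  -- the quotient they are powers of u₁ and still words in x and y.
  agree : h₁ ≅ h₂
  agree = subst₂ _≅_ (sym h₁-formula) (sym h₂-formula) (cong≅
    (∣-by (ring₁ s W) (∣n⇒∣m*n (- W) P∣4σ²))
    (∣-by (ring₂ s W) (∣n⇒∣m*n (+ 2 * s - + 2) ∣-refl))
    (∣-by (ring₃ s W) (∣n⇒∣m*n W q∣8σ²)))
    where
    ring₁ : ∀ s w → (w + + 2 * s * w) - (w + + 2 * s * w + + 2 * s * (+ 2 * s * w)) ≡ - w * (+ 4 * s * s)
    ring₁ = solve-∀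
    ring₂ : ∀ s w → - w - (w - + 2 * s * w) ≡ (+ 2 * s - + 2) * w
    ring₂ = solve-∀
    ring₃ : ∀ s w → (+ 1 + + 4 * s * w - + 4 * s * w) - (+ 1 - + 4 * s * (+ 2 * s * w)) ≡ w * (+ 8 * s * s)
    ring₃ = solve-∀

  -- The exponents of x suffice: up to multiples of 8s² they differ by -8sw.
  disagree : ¬ (mirror h₁ ≅ mirror h₂)
  disagree r = q∤8σw (∣-by (ring s W)
    (∣m∣n⇒∣m+n (∣m⇒∣-m (B≅ (subst₂ (λ g h → mirror g ≅ mirror h) h₁-formula h₂-formula r)))
      (∣n⇒∣m*n (+ 2 * W) q∣8σ²)))
    where
    ring : ∀ s w → + 8 * s * w ≡
      - ((- (+ 1 + + 4 * s * w) - + 4 * s * (w + w)) - (- + 1 - + 4 * s * (w + + 2 * s * w + + 2 * s * w)))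
      + + 2 * w * (+ 8 * s * s)
    ring = solve-∀

  rotary : Rotary (P ℕ.* w) q
  rotary = record
    { E = H ; α = α ; γ = γ ; X = X ; X⁻ = X⁻ ; T = τ
    ; X-X⁻ = X-X⁻ ; X⁻-X = X⁻-X ; T-T = τ-involutive
    ; X-cong  = λ {g} {h} → lift≅ {X} (λ {g} {h} → X-≅ {g} {h}) {g} {h}
    ; X⁻-cong = λ {g} {h} → lift≅ {X⁻} (λ {g} {h} → X⁻-≅ {g} {h}) {g} {h}
    ; T-cong  = λ {g} {h} → lift≅ {τ} (λ {g} {h} → τ-≅ {g} {h}) {g} {h}
    ; α-X = λ _ → refl ; γ-YX = γ-U ; γ-X≢ = γ-X≢
    ; at = at ; α-at = α-at ; γ-at = γ-at
    ; X-orbit = X-orbit ; U-orbit = U-orbit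
    ; L = L
    ; L-cong = λ {m} {m′} {g} {h} → lift≅ {L m m′} (λ {g} {h} → ∙-≅ (m′ ∙ inv m) {g} {h}) {g} {h}
    ; L-X = λ m m′ h → trans (cong (L m m′) (X≡∙x h))
        (trans (sym (∙-assoc (m′ ∙ inv m) h x)) (sym (X≡∙x (L m m′ h))))
    ; L-Y = λ m m′ h → trans (cong (L m m′) (Y≡∙y h))
        (trans (sym (∙-assoc (m′ ∙ inv m) h y)) (sym (Y≡∙y (L m m′ h))))
    ; L-maps = L-maps ; L-L = L-L
    ; o = 1H ; h₁ = h₁ ; m₁ = mirror h₁ ; h₂ = h₂ ; m₂ = mirror h₂
    ; mirror₁ = mirrored-iterate mirrored-X (4 ℕ.* σ ℕ.* w) (mirrored-iterate mirrored-U w (mirrored-X base))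
    ; mirror₂ = mirrored-iterate mirrored-U (2 ℕ.* σ ℕ.* w) (mirrored-X (mirrored-iterate mirrored-U w base))
    ; agree = ≅⇒labels {h₁} {h₂} agree
    ; disagree = λ r → disagree (labels⇒≅ {mirror h₁} {mirror h₂} r) }

-- Arithmetic criterion and prime valuations

chiral : ∀ P w q σ .{{_ : NonZero P}} .{{_ : NonZero w}} .{{_ : NonZero q}} →
  P ℕ.∣ q → q ℕ.∣ 4 ℕ.* σ ℕ.* P → P ℕ.∣ 4 ℕ.* σ ℕ.* σ → q ℕ.∣ 8 ℕ.* σ ℕ.* σ → ¬ (q ℕ.∣ 8 ℕ.* σ ℕ.* w) →
  Coprime P w → 2 ℕ.∣ q ⊎ w ≡ 1 → ChiralPolyhedron (2 ℕ.* (P ℕ.* w)) q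
chiral P w q σ P∣q q∣4σP P∣4σ² q∣8σ² q∤8σw coprime even =
  Construction.chiralPolyhedron (Quotient.rotary P w q σ (∣ᵤ⇒∣ P∣q)
    (signed 4 σ P q∣4σP) (signed 4 σ σ P∣4σ²) (signed 8 σ σ q∣8σ²)
    (λ h → q∤8σw (∣⇒∣ᵤ (subst (+ q ∣_) (sym (pos 8 σ w)) h)))
    coprime parity)
  where
  pos : ∀ i j k → + (i ℕ.* j ℕ.* k) ≡ + i * + j * + k
  pos i j k = trans (ℤ.pos-* (i ℕ.* j) k) (cong (_* + k) (ℤ.pos-* i j))
  signed : ∀ i j k {n} → n ℕ.∣ i ℕ.* j ℕ.* k → + n ∣ + i * + j * + k
  signed i j k {n} h = subst (+ n ∣_) (pos i j k) (∣ᵤ⇒∣ h)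
  -- For even q a residue modulo q has a parity; for w = 1 the group ⟨u₂⟩ is trivial.
  parity : ∀ i j → + q ∣ i - j → + w ∣ odd i - odd j
  parity i j h = [ (λ 2∣q → subst (λ r → + w ∣ odd i - r) (odd-cong i j (∣-trans (∣ᵤ⇒∣ 2∣q) h))
                     (subst (+ w ∣_) (sym (ℤ.+-inverseʳ (odd i))) (divides (+ 0) refl)))
                 , (λ w≡1 → subst (λ n → + n ∣ odd i - odd j) (sym w≡1)
                     (divides (odd i - odd j) (sym (ℤ.*-identityʳ _)))) ]′ even

valuation : ∀ {l} → Prime l → ∀ n → .{{NonZero n}} → ∃ λ i → ∃ λ u → n ≡ l ℕ.^ i ℕ.* u × ¬ (l ℕ.∣ u)
valuation {l} l-prime n = go n (<-wellFounded n)
  where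
  instance _ = prime⇒nonTrivial l-prime
  go : ∀ n → .{{NonZero n}} → Acc _<_ n → ∃ λ i → ∃ λ u → n ≡ l ℕ.^ i ℕ.* u × ¬ (l ℕ.∣ u)
  go n (acc rec) with l ℕ.∣? n
  ... | no l∤n = 0 , n , sym (ℕ.*-identityˡ n) , l∤n
  ... | yes l∣n = let i , u , n≡ , l∤u = go _ {{ℕ.quotient≢0 l∣n}} (rec (ℕ.quotient-< l∣n)) in
      suc i , u , trans (ℕ.m∣n⇒n≡m*quotient l∣n) (trans (cong (l ℕ.*_) n≡) (sym (ℕ.*-assoc l (l ℕ.^ i) u))) , l∤u

^∣⇒≤ : ∀ {l} k i {u} → .{{NonZero l}} → ¬ (l ℕ.∣ u) → l ℕ.^ k ℕ.∣ l ℕ.^ i ℕ.* u → k ≤ i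
^∣⇒≤ zero    i l∤u h = z≤n
^∣⇒≤ {l} (suc k) zero {u} l∤u h =
  contradiction (subst (l ℕ.∣_) (ℕ.*-identityˡ u) (ℕ.∣-trans (ℕ.m∣m*n (l ℕ.^ k)) h)) l∤u
^∣⇒≤ {l} (suc k) (suc i) {u} l∤u h =
  s≤s (^∣⇒≤ k i l∤u (ℕ.*-cancelˡ-∣ l (subst (l ℕ.* l ℕ.^ k ℕ.∣_) (ℕ.*-assoc l (l ℕ.^ i) u) h)))

^-mono-∣ : ∀ l {i j} → i ≤ j → l ℕ.^ i ℕ.∣ l ℕ.^ j
^-mono-∣ l {j = j} z≤n = ℕ.1∣ (l ℕ.^ j)
^-mono-∣ l (s≤s i≤j)   = ℕ.*-monoʳ-∣ l (^-mono-∣ l i≤j)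

coprime-^ : ∀ {l u} → Prime l → ¬ (l ℕ.∣ u) → ∀ i → Coprime (l ℕ.^ i) u
coprime-^ l-prime l∤u zero (d∣1 , _) = ℕ.∣1⇒≡1 d∣1
coprime-^ {l} {u} l-prime l∤u (suc i) {d} (d∣lⁱ , d∣u) =
  coprime-^ l-prime l∤u i (coprime-divisor d⊥l d∣lⁱ , d∣u)
  where
  d⊥l : Coprime d l
  d⊥l (c∣d , c∣l) with prime⇒irreducible l-prime c∣l
  ... | inj₁ c≡1  = c≡1
  ... | inj₂ refl = contradiction (ℕ.∣-trans c∣d d∣u) l∤u

∤⇒nonZero : ∀ {l u} → ¬ (l ℕ.∣ u) → NonZero u
∤⇒nonZero {l} {zero}  l∤u = contradiction (l ℕ.∣0) l∤u
∤⇒nonZero {l} {suc u} l∤u = _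

odd-prime∤2 : ∀ {m} → Prime m → ¬ (2 ℕ.∣ m) → ¬ (m ℕ.∣ 2)
odd-prime∤2 m-prime 2∤m m∣2 with irreducible[2] m∣2
... | inj₁ refl = ¬prime[1] m-prime
... | inj₂ refl = 2∤m ℕ.∣-refl

odd-prime∣half : ∀ {m} n → Prime m → ¬ (2 ℕ.∣ m) → m ℕ.∣ n ℕ.* 2 → m ℕ.∣ n
odd-prime∣half n m-prime 2∤m h with euclidsLemma n 2 m-prime h
... | inj₁ m∣n = m∣n
... | inj₂ m∣2 = contradiction m∣2 (odd-prime∤2 m-prime 2∤m)

-- Choice of s

-- With s = q/m the element z has order m.
chiral-odd : ∀ {m} P w q .{{_ : NonZero P}} .{{_ : NonZero w}} .{{_ : NonZero q}} →
  Prime m → ¬ (2 ℕ.∣ m) → m ℕ.∣ P → m ℕ.* m ℕ.∣ q → P ℕ.∣ q → Coprime P w → 2 ℕ.∣ q ⊎ w ≡ 1 →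
  ChiralPolyhedron (2 ℕ.* (P ℕ.* w)) q
chiral-odd {m} P@.(c ℕ.* m) w q@.(r ℕ.* (m ℕ.* m)) m-prime 2∤m (divides c refl) (divides r refl) P∣q P⊥w even =
  chiral P w q t P∣q
    (divides (4 ℕ.* c) (ring₁ r m c))
    (ℕ.∣-trans P∣q (divides (4 ℕ.* r) (ring₂ r m)))
    (divides (8 ℕ.* r) (ring₃ r m))
    q∤8tw P⊥w even
  where
  t = r ℕ.* m
  ring₁ : ∀ r m c → 4 ℕ.* (r ℕ.* m) ℕ.* (c ℕ.* m) ≡ 4 ℕ.* c ℕ.* (r ℕ.* (m ℕ.* m))
  ring₁ = ℕSolver.solve-∀
  ring₂ : ∀ r m → 4 ℕ.* (r ℕ.* m) ℕ.* (r ℕ.* m) ≡ 4 ℕ.* r ℕ.* (r ℕ.* (m ℕ.* m))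
  ring₂ = ℕSolver.solve-∀
  ring₃ : ∀ r m → 8 ℕ.* (r ℕ.* m) ℕ.* (r ℕ.* m) ≡ 8 ℕ.* r ℕ.* (r ℕ.* (m ℕ.* m))
  ring₃ = ℕSolver.solve-∀
  ring₄ : ∀ r m → r ℕ.* (m ℕ.* m) ≡ r ℕ.* m ℕ.* m
  ring₄ = ℕSolver.solve-∀
  ring₅ : ∀ t w → 8 ℕ.* t ℕ.* w ≡ t ℕ.* (w ℕ.* 2 ℕ.* 2 ℕ.* 2)
  ring₅ = ℕSolver.solve-∀
  instance
    t≢0 : NonZero t
    t≢0 = ℕ.m*n≢0⇒m≢0 t {{subst NonZero (ring₄ r m) it}}
      where
      it : NonZero q
      it = ℕ.≢-nonZero (ℕ.≢-nonZero⁻¹ q)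
  q∤8tw : ¬ (q ℕ.∣ 8 ℕ.* t ℕ.* w)
  -- Cancelling t = q/m leaves m ∣ 8w, hence m ∣ w as m is odd. But m also divides P, which is
  -- coprime to w.
  q∤8tw h = ¬prime[1] (subst Prime (P⊥w (ℕ.n∣m*n c , halve (halve (halve (ℕ.*-cancelˡ-∣ t
    (subst₂ ℕ._∣_ (ring₄ r m) (ring₅ t w) h)))))) m-prime)
    where
    halve : ∀ {n} → m ℕ.∣ n ℕ.* 2 → m ℕ.∣ n
    halve = odd-prime∣half _ m-prime 2∤m

-- With q = 16r and s = r the element z has order 4.
chiral-even : ∀ P w r .{{_ : NonZero P}} .{{_ : NonZero w}} .{{_ : NonZero r}} →
  4 ℕ.∣ P → P ℕ.∣ 8 ℕ.* r → 2 ℕ.∣ r → Coprime P w → ChiralPolyhedron (2 ℕ.* (P ℕ.* w)) (16 ℕ.* r)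
chiral-even P@.(c ℕ.* 4) w r@.(t ℕ.* 2) (divides c refl) P∣8r (divides t refl) P⊥w =
  chiral P w (16 ℕ.* r) r
    (ℕ.∣-trans P∣8r (divides 2 (ring₁ r)))
    (divides c (ring₂ c r))
    (ℕ.∣-trans P∣8r (divides t (ring₃ t)))
    (divides t (ring₄ t))
    16r∤8rw P⊥w (inj₁ (divides (8 ℕ.* r) (ring₅ r)))
  where
  ring₁ : ∀ r → 16 ℕ.* r ≡ 2 ℕ.* (8 ℕ.* r)
  ring₁ = ℕSolver.solve-∀
  ring₂ : ∀ c r → 4 ℕ.* r ℕ.* (c ℕ.* 4) ≡ c ℕ.* (16 ℕ.* r)
  ring₂ = ℕSolver.solve-∀
  ring₃ : ∀ t → 4 ℕ.* (t ℕ.* 2) ℕ.* (t ℕ.* 2) ≡ t ℕ.* (8 ℕ.* (t ℕ.* 2))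
  ring₃ = ℕSolver.solve-∀
  ring₄ : ∀ t → 8 ℕ.* (t ℕ.* 2) ℕ.* (t ℕ.* 2) ≡ t ℕ.* (16 ℕ.* (t ℕ.* 2))
  ring₄ = ℕSolver.solve-∀
  ring₅ : ∀ r → 16 ℕ.* r ≡ 8 ℕ.* r ℕ.* 2
  ring₅ = ℕSolver.solve-∀
  instance
    16r≢0 : NonZero (16 ℕ.* r)
    16r≢0 = ℕ.m*n≢0 16 r
  16r∤8rw : ¬ (16 ℕ.* r ℕ.∣ 8 ℕ.* r ℕ.* w)
  -- Cancelling 8r leaves 2 ∣ w, whereas P is even and coprime to w.
  16r∤8rw h = contradiction
    (P⊥w (divides (c ℕ.* 2) (sym (ℕ.*-assoc c 2 2)) , ℕ.*-cancelˡ-∣ (8 ℕ.* r) {{ℕ.m*n≢0 8 r}} (subst (ℕ._∣ 8 ℕ.* r ℕ.* w) (ring₅ r) h)))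
    λ ()

-- Up to duality the l-part of p divides that of q.
symmetric : ∀ {l} a b → a ≤ b → Prime l →
  (∀ i j u v → a ≤ i → i ≤ j → b ≤ j → ¬ (l ℕ.∣ u) → ¬ (l ℕ.∣ v) →
    ChiralPolyhedron (2 ℕ.* (l ℕ.^ i ℕ.* u)) (2 ℕ.* (l ℕ.^ j ℕ.* v))) →
  ∀ p q .{{_ : NonZero p}} .{{_ : NonZero q}} → l ℕ.^ a ℕ.∣ p → l ℕ.^ b ℕ.∣ q → ChiralPolyhedron (p ℕ.* 2) (q ℕ.* 2)
symmetric {l} a b a≤b l-prime build p q lᵃ∣p lᵇ∣q with valuation l-prime p | valuation l-prime q
... | i , u , refl , l∤u | j , v , refl , l∤v =
  subst₂ ChiralPolyhedron (ℕ.*-comm 2 (l ℕ.^ i ℕ.* u)) (ℕ.*-comm 2 (l ℕ.^ j ℕ.* v)) (ordered (ℕ.≤-total i j))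
  where
  instance _ = prime⇒nonZero l-prime
  a≤i = ^∣⇒≤ a i l∤u lᵃ∣p
  b≤j = ^∣⇒≤ b j l∤v lᵇ∣q
  ordered : i ≤ j ⊎ j ≤ i → ChiralPolyhedron (2 ℕ.* (l ℕ.^ i ℕ.* u)) (2 ℕ.* (l ℕ.^ j ℕ.* v))
  ordered (inj₁ i≤j) = build i j u v a≤i i≤j b≤j l∤u l∤v
  -- Here a ≤ b ≤ j ≤ i, so both lower bounds hold with the roles of p and q exchanged.
  ordered (inj₂ j≤i) = ChiralPolyhedron-dual
    (build j i v u (ℕ.≤-trans a≤b b≤j) j≤i (ℕ.≤-trans b≤j j≤i) l∤v l∤u)

-- The three conditions

-- For odd q, x has odd order and cannot invert a nontrivial u₂, so w = 1 and P = p/2. The condition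
-- p ∣ 2q is then exactly P ∣ q.
chiral-A : ∀ p q → .{{NonZero p}} → .{{NonZero q}} → CondA p q → ChiralPolyhedron p q
chiral-A p@.(P ℕ.* 2) q (_ , divides P refl , p∣2q , m , m-prime , 2∤m , m∣p , m²∣q) =
  subst (λ n → ChiralPolyhedron n q) (ring P)
    (chiral-odd P 1 q {{ℕ.m*n≢0⇒m≢0 P}} m-prime 2∤m (odd-prime∣half P m-prime 2∤m m∣p) m²∣q
      (ℕ.*-cancelʳ-∣ 2 (subst (P ℕ.* 2 ℕ.∣_) (ℕ.*-comm 2 q) p∣2q)) (λ (_ , d∣1) → ℕ.∣1⇒≡1 d∣1) (inj₂ refl))
  where
  ring : ∀ P → 2 ℕ.* (P ℕ.* 1) ≡ P ℕ.* 2
  ring = ℕSolver.solve-∀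

-- As m is odd, halving p and q keeps the divisibility by m and m². P is the m-part of p/2, and the
-- complementary factor w is unrestricted because q is even.
chiral-B : ∀ p q → .{{NonZero p}} → .{{NonZero q}} → CondB p q → ChiralPolyhedron p q
chiral-B p@.(p′ ℕ.* 2) q@.(q′ ℕ.* 2) (divides p′ refl , divides q′ refl , m , m-prime , 2∤m , m∣p , m²∣q) =
  symmetric 1 2 (s≤s z≤n) m-prime build p′ q′ {{ℕ.m*n≢0⇒m≢0 p′}} {{ℕ.m*n≢0⇒m≢0 q′}}
    (subst (ℕ._∣ p′) (sym (ℕ.*-identityʳ m)) (halve m∣p))
    (subst (ℕ._∣ q′) (cong (m ℕ.*_) (sym (ℕ.*-identityʳ m))) square)
  where
  instance
    m≢0 : NonZero m
    m≢0 = prime⇒nonZero m-prime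
  halve : ∀ {n} → m ℕ.∣ n ℕ.* 2 → m ℕ.∣ n
  halve = odd-prime∣half _ m-prime 2∤m
  square : m ℕ.* m ℕ.∣ q′
  square with halve {q′} (ℕ.∣-trans (ℕ.m∣m*n m) m²∣q)
  ... | divides c refl = ℕ.*-monoˡ-∣ m (halve {c} (ℕ.*-cancelʳ-∣ m (subst (m ℕ.* m ℕ.∣_) (ring c m) m²∣q)))
    where
    ring : ∀ c m → c ℕ.* m ℕ.* 2 ≡ c ℕ.* 2 ℕ.* m
    ring = ℕSolver.solve-∀
  build : ∀ i j u v → 1 ≤ i → i ≤ j → 2 ≤ j → ¬ (m ℕ.∣ u) → ¬ (m ℕ.∣ v) →
    ChiralPolyhedron (2 ℕ.* (m ℕ.^ i ℕ.* u)) (2 ℕ.* (m ℕ.^ j ℕ.* v))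
  build i j u v 1≤i i≤j 2≤j m∤u m∤v =
    chiral-odd (m ℕ.^ i) u (2 ℕ.* (m ℕ.^ j ℕ.* v)) {{ℕ.m^n≢0 m i}} {{∤⇒nonZero m∤u}}
      {{ℕ.m*n≢0 2 (m ℕ.^ j ℕ.* v) {{_}} {{ℕ.m*n≢0 (m ℕ.^ j) v {{ℕ.m^n≢0 m j}} {{∤⇒nonZero m∤v}}}}}}
      m-prime 2∤m
      (subst (ℕ._∣ m ℕ.^ i) (ℕ.*-identityʳ m) (^-mono-∣ m 1≤i))
      (subst (ℕ._∣ 2 ℕ.* (m ℕ.^ j ℕ.* v)) (cong (m ℕ.*_) (ℕ.*-identityʳ m)) (power 2≤j))
      (power i≤j) (coprime-^ m-prime m∤u i) (inj₁ (ℕ.m∣m*n (m ℕ.^ j ℕ.* v)))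
    where
    power : ∀ {k} → k ≤ j → m ℕ.^ k ℕ.∣ 2 ℕ.* (m ℕ.^ j ℕ.* v)
    power k≤j = ℕ.∣n⇒∣m*n 2 (ℕ.∣m⇒∣m*n v (^-mono-∣ m k≤j))

-- The bounds 8 and 32 make P, the 2-part of p/2, divisible by 4 and r = q/16 even. With s = r the
-- first gives q ∣ 4sP and the second q ∣ 8s²; P ∣ 8r, the result of ordering the 2-parts, then
-- gives P ∣ 4s².
chiral-C : ∀ p q → .{{NonZero p}} → .{{NonZero q}} → CondC p q → ChiralPolyhedron p q
chiral-C p@.(c ℕ.* 8) q@.(d ℕ.* 32) (divides c refl , divides d refl) =
  subst₂ ChiralPolyhedron (ℕ.*-assoc c 4 2) (ℕ.*-assoc d 16 2)
    (symmetric 2 4 (s≤s (s≤s z≤n)) prime[2] build (c ℕ.* 4) (d ℕ.* 16)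
      {{ℕ.m*n≢0 c 4 {{ℕ.m*n≢0⇒m≢0 c}}}} {{ℕ.m*n≢0 d 16 {{ℕ.m*n≢0⇒m≢0 d}}}} (ℕ.n∣m*n c) (ℕ.n∣m*n d))
  where
  build : ∀ i j u v → 2 ≤ i → i ≤ j → 4 ≤ j → ¬ (2 ℕ.∣ u) → ¬ (2 ℕ.∣ v) →
    ChiralPolyhedron (2 ℕ.* (2 ℕ.^ i ℕ.* u)) (2 ℕ.* (2 ℕ.^ j ℕ.* v))
  build i j@(suc (suc (suc (suc k)))) u v 2≤i i≤j (s≤s (s≤s (s≤s (s≤s z≤n)))) 2∤u 2∤v =
    subst (ChiralPolyhedron (2 ℕ.* (2 ℕ.^ i ℕ.* u))) (ring₁ (2 ℕ.^ k) v)
      (chiral-even (2 ℕ.^ i) u r {{ℕ.m^n≢0 2 i}} {{∤⇒nonZero 2∤u}}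
        {{ℕ.m*n≢0 2 (2 ℕ.^ k ℕ.* v) {{_}} {{ℕ.m*n≢0 (2 ℕ.^ k) v {{ℕ.m^n≢0 2 k}} {{∤⇒nonZero 2∤v}}}}}}
        (^-mono-∣ 2 2≤i)
        (ℕ.∣-trans (^-mono-∣ 2 i≤j) (divides v (ring₂ (2 ℕ.^ k) v)))
        (ℕ.m∣m*n (2 ℕ.^ k ℕ.* v)) (coprime-^ prime[2] 2∤u i))
    where
    r = 2 ℕ.* (2 ℕ.^ k ℕ.* v)
    ring₁ : ∀ x v → 16 ℕ.* (2 ℕ.* (x ℕ.* v)) ≡ 2 ℕ.* ((2 ℕ.* (2 ℕ.* (2 ℕ.* (2 ℕ.* x)))) ℕ.* v)
    ring₁ = ℕSolver.solve-∀
    ring₂ : ∀ x v → 8 ℕ.* (2 ℕ.* (x ℕ.* v)) ≡ v ℕ.* (2 ℕ.* (2 ℕ.* (2 ℕ.* (2 ℕ.* x))))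
    ring₂ = ℕSolver.solve-∀

theorem3p15 : (p q : ℕ) → 2 ≤ p → 2 ≤ q →
    CondA p q ⊎ CondB p q ⊎ CondC p q →
    TightChiralPolyhedron p q × TightChiralPolyhedron q p
theorem3p15 p q 2≤p 2≤q cond = tight chiral-pq , tight (ChiralPolyhedron-dual chiral-pq)
  where
  instance
    p≢0 : NonZero p
    p≢0 = ℕ.>-nonZero (ℕ.≤-trans (s≤s z≤n) 2≤p)
    q≢0 : NonZero q
    q≢0 = ℕ.>-nonZero (ℕ.≤-trans (s≤s z≤n) 2≤q)
  chiral-pq : ChiralPolyhedron p q
  chiral-pq = [ chiral-A p q , [ chiral-B p q , chiral-C p q ]′ ]′ cond
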